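{- The problem $\mathrm{PartSynth}(\mathrm{FO}[\sim])$ is decidable; that is, there is an algorithm which, given a finite alphabet $A=A_S\uplus A_E$ of actions and a sentence $\varphi\in\mathrm{FO}[\sim]$ over $A$, decides whether there exist finite disjoint sets of processes $\mathbb{P}_S$ and $\mathbb{P}_E$ (with no shared processes) such that System has a winning strategy for $\varphi$.
   Context: **Data words.** $A$ is a finite alphabet of actions, partitioned into System actions $A_S$ and Environment actions $A_E$. Processes are partitioned between the players: $\mathbb{P}_S$ (System processes) and $\mathbb{P}_E$ (Environment processes) are disjoint finite sets, and there is no shared process. Let $\Sigma_S := A_S\times\mathbb{P}_S$, $\Sigma_E := A_E\times\mathbb{P}_E$, $\Sigma:=\Sigma_S\cup\Sigma_E$. A data word is a finite or infinite sequence $w=(a_0,p_0)(a_1,p_1)\cdots$ over $\Sigma$; each pair $(a_i,p_i)$ in the sequence is called a position. **Logic.** Formulas of $\mathrm{FO}[\sim]$ are first-order formulas (any number of variables; connectives $\neg,\land,\lor,\exists,\forall$) built from the atoms $a(x)$ for $a\in A$, $x=y$, $x\sim y$, $\mathbb{P}_S(x)$, $\mathbb{P}_E(x)$ (and $\mathbb{P}_{SE}(x)$, for shared processes, which is interpreted as the empty set here). A data word is represented as a structure whose domain has one element for each position and one element for each process in $\mathbb{P}_S\cup\mathbb{P}_E$ (including processes on which no action is played). $\mathbb{P}_S$ (resp. $\mathbb{P}_E$) is interpreted as the set of process elements of System (resp. Environment); $a$ is interpreted as the set of positions whose action is $a$; $\sim$ is the equivalence relation such that two positions $(a_i,p_i)$,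 $(a_j,p_j)$ are related iff $p_i=p_j$, and each process element $p$ is related to all positions of the form $(a,p)$. **Strategies.** A strategy for System is a function $\mathcal{S}:\Sigma^*\to\Sigma_S\cup\{\varepsilon\}$. An execution (data word) $w=\sigma_0\sigma_1\cdots$ is $\mathcal{S}$-compatible if (i) for all $0\le i<|w|$, $\sigma_i\in\Sigma_S$ implies $\sigma_i=\mathcal{S}(\sigma_0\cdots\sigma_{i-1})$, and (ii) if $w$ is finite then $\mathcal{S}(w)=\varepsilon$. It is fair for $\mathcal{S}$ if, whenever there are infinitely many $i$ with $\mathcal{S}(\sigma_0\cdots\sigma_{i-1})\neq\varepsilon$, there are infinitely many positions of $w$ in $\Sigma_S$. $\mathcal{S}$ is winning for $\varphi$ if all executions that are $\mathcal{S}$-compatible and fair for $\mathcal{S}$ satisfy $\varphi$. **Problem.** For a logic $\mathcal{L}$, $\mathrm{PartSynth}(\mathcal{L})$ is the problem: given $A=A_S\uplus A_E$ and a sentence $\varphi\in\mathcal{L}$, decide whether System has a winning strategy for $\varphi$ for some arbitrary finite sets $\mathbb{P}_S$ and $\mathbb{P}_E$ (no shared processes). -}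

module Defs where

open import Data.Empty using (⊥)
open import Data.Fin using (Fin; toℕ)
open import Data.List using (List; length; lookup; take; applyUpTo)
open import Data.Maybe using (Maybe; just; nothing)
open import Data.Nat using (ℕ; suc; _≤_)
open import Data.Product using (∃; ∃-syntax; _×_; _,_; proj₁; proj₂)
import Data.Sum as Sum
open import Data.Sum using (_⊎_; inj₁; inj₂)
open import Data.Vec.Functional using (Vector; _∷_; [])
open import Relation.Nullary using (¬_)
open import Relation.Binary.PropositionalEquality using (_≡_; _≢_)

-- A finite set X = X_S ⊎ X_E split between System and Environment, up to
-- renaming of its elements.  Either part may be empty.  Used for the action
-- alphabet A as well as for the set of processes.
record FiniteSplit : Set where
  constructor split
  field
    sizeS : ℕ
    sizeE : ℕ

  System : Set
  System = Fin sizeS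

  Environment : Set
  Environment = Fin sizeE

  Element : Set
  Element = System ⊎ Environment

open FiniteSplit

-- Well-scoped de Bruijn syntax: the variables of a `Formula A n` are the
-- elements of `Fin n`, and a quantifier binds variable `zero` of its body.
data Formula (A : FiniteSplit) (n : ℕ) : Set where
  act         : Element A → Fin n → Formula A n
  _≐_ _∼_     : Fin n → Fin n → Formula A n
  ℙS ℙE ℙSE   : Fin n → Formula A n
  ¬′_         : Formula A n → Formula A n
  _∧′_ _∨′_   : Formula A n → Formula A n → Formula A n
  ∃′_ ∀′_     : Formula A (suc n) → Formula A n

Sentence : FiniteSplit → Set
Sentence A = Formula A 0

module Game (A P : FiniteSplit) where

  LetterS LetterE Letter : Set
  LetterS = System A × System P
  LetterE = Environment A × Environment P
  Letter  = LetterS ⊎ LetterE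

  action : Letter → Element A
  action = Sum.map proj₁ proj₁

  process : Letter → Element P
  process = Sum.map proj₂ proj₂

  data DataWord : Set where
    finite   : List Letter → DataWord
    infinite : (ℕ → Letter) → DataWord

  Position : DataWord → Set
  Position (finite w)   = Fin (length w)
  Position (infinite w) = ℕ

  index : (w : DataWord) → Position w → ℕ
  index (finite w)   i = toℕ i
  index (infinite w) i = i

  letterAt : (w : DataWord) → Position w → Letter
  letterAt (finite w)   i = lookup w i
  letterAt (infinite w) i = w i

  -- σ₀ ⋯ σᵢ₋₁
  prefix : (w : DataWord) → Position w → List Letter
  prefix (finite w)   i = take (toℕ i) w
  prefix (infinite w) i = applyUpTo w i

  Domain : DataWord → Set
  Domain w = Position w ⊎ Element P

  processOf : (w : DataWord) → Domain w → Element P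
  processOf w (inj₁ i) = process (letterAt w i)
  processOf w (inj₂ p) = p

  -- Satisfaction is classical truth.  Since the domain may be infinite, ∨ and ∃
  -- are read through double negation; the atoms are decidable, so every formula
  -- has a ¬¬-stable meaning and all classical laws hold.
  infix 4 _,_⊨_
  _,_⊨_ : ∀ {n} (w : DataWord) → Vector (Domain w) n → Formula A n → Set
  w , ρ ⊨ act a x  = ∃[ i ] ρ x ≡ inj₁ i × action (letterAt w i) ≡ a
  w , ρ ⊨ (x ≐ y)  = ρ x ≡ ρ y
  w , ρ ⊨ (x ∼ y)  = processOf w (ρ x) ≡ processOf w (ρ y)
  w , ρ ⊨ ℙS x     = ∃[ p ] ρ x ≡ inj₂ (inj₁ p)
  w , ρ ⊨ ℙE x     = ∃[ p ] ρ x ≡ inj₂ (inj₂ p)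
  w , ρ ⊨ ℙSE x    = ⊥
  w , ρ ⊨ (¬′ φ)   = ¬ (w , ρ ⊨ φ)
  w , ρ ⊨ (φ ∧′ ψ) = (w , ρ ⊨ φ) × (w , ρ ⊨ ψ)
  w , ρ ⊨ (φ ∨′ ψ) = ¬ ¬ ((w , ρ ⊨ φ) ⊎ (w , ρ ⊨ ψ))
  w , ρ ⊨ (∃′ φ)   = ¬ ¬ (∃[ d ] w , (d ∷ ρ) ⊨ φ)
  w , ρ ⊨ (∀′ φ)   = ∀ d → w , (d ∷ ρ) ⊨ φ

  infix 4 _⊨_
  _⊨_ : DataWord → Sentence A → Set
  w ⊨ φ = w , [] ⊨ φ

  -- `nothing` is ε.
  Strategy : Set
  Strategy = List Letter → Maybe LetterS

  StopsAtEnd : Strategy → DataWord → Set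
  StopsAtEnd 𝒮 w = ∀ u → w ≡ finite u → 𝒮 u ≡ nothing

  Compatible : Strategy → DataWord → Set
  Compatible 𝒮 w =
    (∀ i s → letterAt w i ≡ inj₁ s → 𝒮 (prefix w i) ≡ just s) × StopsAtEnd 𝒮 w

  -- Classical "infinitely many", hence the double negation; it never holds
  -- when w is finite.
  InfinitelyOften : (w : DataWord) → (Position w → Set) → Set
  InfinitelyOften w Q = ∀ n → ¬ ¬ (∃[ i ] n ≤ index w i × Q i)

  Fair : Strategy → DataWord → Set
  Fair 𝒮 w =
    InfinitelyOften w (λ i → 𝒮 (prefix w i) ≢ nothing) →
    InfinitelyOften w (λ i → ∃[ s ] letterAt w i ≡ inj₁ s)

  Winning : Sentence A → Strategy → Set
  Winning φ 𝒮 = ∀ w → Compatible 𝒮 w → Fair 𝒮 w → w ⊨ φ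

PartSynth : (A : FiniteSplit) → Sentence A → Set
PartSynth A φ = ∃[ P ] ∃[ 𝒮 ] Game.Winning A P φ 𝒮

{-# OPTIONS --safe #-}

-- A sentence of rank B only sees, for every process, how often it plays each
-- action, and how many processes share these counts, all numbers being capped
-- at B.  Counts only grow, processes are not shared, and fairness lets System
-- complete any move it insists on.  So the game is a finite alternation: System
-- raises its counts to reach an accepted configuration, Environment raises one
-- of its counts, and so on.
-- System processes: by pigeonhole on their behaviour in such a finite strategy,
-- one of sufficiently many has B twins and can be removed.
-- Environment processes: System can simulate one more process, a ghost, which
-- stays where at least B real ones are.  When these leave, many of a large crowd
-- have moved to a common place above, and the ghost follows them; this happens
-- only boundedly often.  So large numbers of both kinds of processes can be decreased.
module Submission where

open import Defs
open FiniteSplit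
open import Data.Bool using (if_then_else_)
open import Data.Empty using (⊥; ⊥-elim)
open import Data.Fin using (Fin; zero; suc; toℕ; punchIn; punchOut)
import Data.Fin.Properties as Fin
open import Data.List
  using (List; []; _∷_; length; lookup; take; drop; applyUpTo; allFin; cartesianProduct; cartesianProductWith;
         foldl; replicate; _++_; _∷ʳ_)
import Data.List as List
open import Data.List.Membership.Propositional using (_∈_; lose; find)
open import Data.List.Membership.Propositional.Properties
  using (∈-allFin; ∈-cartesianProduct⁺; ∈-cartesianProductWith⁺; ∈-++⁺ˡ; ∈-++⁺ʳ; ∈-map⁺)
import Data.List.Properties as List
open import Data.List.Relation.Unary.Any using (any?; here; there; tail)
open import Data.List.Reverse using (Reverse; reverseView; []; _∶_∶ʳ_)
open import Data.Maybe using (just; nothing; maybe)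
open import Data.Nat
open import Data.Nat.Properties
open import Data.Product using (∃; ∃-syntax; _×_; _,_; proj₁; proj₂)
import Data.Product.Properties as Product
open import Data.Sum using (_⊎_; inj₁; inj₂)
import Data.Sum as Sum
import Data.Sum.Properties as Sum
open import Data.Unit using (⊤; tt)
open import Data.Vec using (Vec; []; _∷_)
import Data.Vec as Vec
open import Data.Vec.Functional using () renaming (_∷_ to _∷ᶠ_)
import Data.Vec.Properties as Vec
open import Function using (_∘_; id; flip)
open import Relation.Binary.Definitions using (DecidableEquality)
open import Relation.Binary.PropositionalEquality
open import Relation.Nullary
open import Relation.Nullary.Decidable using (¬¬-excluded-middle; decidable-stable; _×-dec_; _⊎-dec_; ¬?; map′)
open import Relation.Unary using (Decidable)

-- Strategies and words range over infinite sets, the finite game does not. So what is extracted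
-- from a strategy or a word (a halting time, a point of stabilisation, a reply in an
-- Ehrenfeucht-Fraïssé game) is found under double negation only. This is shed once `Wins`, which is
-- decidable, has been reached. Two versions of the game are needed. With single moves it is
-- decidable, and its witnesses are finite trees, so that a System process has finitely many
-- behaviours. Lists of moves serve the ghost: after the real moves it may need several increments
-- before it is hidden again, and acceptance must not be tested in between. The order of the cutoffs
-- matters. The bound on Environment processes depends on the alphabet and the rank alone, neither
-- on the System processes nor on the length of the game. The bound on System processes depends on
-- `m`, through the number of effective moves Environment has. So `m` is bounded first, and then `n`
-- for each `m`.

private variable
  X Y : Set
  Q Q′ : X → Set
  a n n′ m m′ : ℕ

-- Cardinalities up to a threshold

_∖_ : (X → Set) → X → X → Set
(Q ∖ x) y = Q y × y ≢ x

-- Q has t elements, where all sizes of at least k are identified.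
Card : ℕ → (X → Set) → ℕ → Set
Card zero    Q t       = ⊤
Card (suc k) Q zero    = ∀ x → ¬ Q x
Card (suc k) Q (suc t) = ¬ ¬ ∃ Q × (∀ x → Q x → Card k (Q ∖ x) t)

card-ext : ∀ k {t} → (∀ x → Q x → Q′ x) → (∀ x → Q′ x → Q x) → Card k Q t → Card k Q′ t
card-ext zero            f g c       = tt
card-ext (suc k) {zero}  f g c x q′  = c x (g x q′)
card-ext (suc k) {suc t} f g (e , c) =
  (λ κ → e λ (x , q) → κ (x , f x q)) ,
  λ x q′ → card-ext k (λ y (q , ne) → f y q , ne) (λ y (q , ne) → g y q , ne) (c x (g x q′))

card-weaken : ∀ {j k t} → j ≤ k → Card k Q t → Card j Q t
card-weaken {j = zero}              _       c       = tt
card-weaken {j = suc j} {t = zero}  (s≤s l) c       = c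
card-weaken {j = suc j} {t = suc t} (s≤s l) (e , c) = e , λ x q → card-weaken l (c x q)

-- `Card` asks for the right size after deleting any element, not just `d`. For another `x` the two
-- deletions are swapped, and the induction hypothesis puts `d` back.
card-insert : DecidableEquality X → ∀ k {t} {Q : X → Set} {d} → Q d →
              Card k (Q ∖ d) t → Card (suc k) Q (suc t)
card-insert _≟_ zero {d = d} q c = (λ κ → κ (d , q)) , λ _ _ → tt
card-insert _≟_ (suc k) {t} {Q} {d} q c = (λ κ → κ (d , q)) , λ x qx → remove t c x qx (x ≟ d)
  where
  remove : ∀ t → Card (suc k) (Q ∖ d) t → ∀ x → Q x → Dec (x ≡ d) → Card (suc k) (Q ∖ x) t
  remove t       c       x qx (yes refl) = c
  remove zero    c       x qx (no ne)    = ⊥-elim (c x (qx , ne))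
  remove (suc t) (e , c) x qx (no ne)    =
    card-insert _≟_ k (q , ne ∘ sym)
      (card-ext k (λ y ((q , a) , b) → (q , b) , a) (λ y ((q , a) , b) → (q , b) , a) (c x (qx , ne)))

card-cap : ∀ k {t t′} → k ≤ t → k ≤ t′ → Card k Q t → Card k Q t′
card-cap zero    l       l′       c       = tt
card-cap (suc k) (s≤s l) (s≤s l′) (e , c) = e , λ x q → card-cap k l l′ (c x q)

-- With `k ≤ t` only "at least `k`" is claimed, which passes to supersets. Deleting an `x` outside
-- `Q′` costs `Q′` nothing, and `card-cap` evens out the surplus.
card-⊇ : ∀ k {t} {Q Q′ : X → Set} → Decidable Q′ → DecidableEquality X → (∀ x → Q′ x → Q x) → k ≤ t →
         Card k Q′ t → Card k Q t
card-⊇ zero Q′? _≟_ sub l c = tt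
card-⊇ (suc k) {suc t} {Q} {Q′} Q′? _≟_ sub (s≤s l) (e , c) =
  (λ κ → e λ (x , q) → κ (x , sub x q)) ,
  λ x q → card-⊇ k (λ y → Q′? y ×-dec ¬? (y ≟ x)) _≟_ (λ y (q , ne) → sub y q , ne) l (rest x (Q′? x))
  where
  rest : ∀ x → Dec (Q′ x) → Card k (Q′ ∖ x) t
  rest x (yes q) = c x q
  rest x (no nq) = card-ext k (λ y q → q , λ { refl → nq q }) (λ y → proj₁)
    (card-cap k (m≤n⇒m≤1+n l) l (card-weaken (n≤1+n k) (e , c)))

card-inj : ∀ k {t} {Q : Y → Set} (f : X → Y) → (∀ {x y} → f x ≡ f y → x ≡ y) →
           (∀ y → Q y → ∃[ x ] f x ≡ y) → Card k (Q ∘ f) t → Card k Q t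
card-inj zero f inj cov c = tt
card-inj (suc k) {zero} {Q} f inj cov c y q with x , refl ← cov y q = c x q
card-inj (suc k) {suc t} {Q} f inj cov (e , c) =
  (λ κ → e λ (x , q) → κ (f x , q)) , del
  where
  del : ∀ y → Q y → Card k (Q ∖ y) t
  del y q with x , refl ← cov y q =
    card-inj k f inj (λ y (q , _) → cov y q)
      (card-ext k (λ z (q , ne) → q , ne ∘ inj) (λ z (q , ne) → q , ne ∘ cong f) (c x q))

count : ∀ {n} {Q : Fin n → Set} → Decidable Q → ℕ
count {zero}  Q? = 0
count {suc n} Q? = (if does (Q? zero) then 1 else 0) + count (Q? ∘ suc)

card-count : ∀ k {n} {Q : Fin n → Set} (Q? : Decidable Q) → Card k Q (count Q?)
card-count zero            Q? = tt
card-count (suc k) {zero}  Q? = λ ()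
card-count (suc k) {suc n} {Q} Q? with Q? zero
... | yes q = card-insert Fin._≟_ k q
      (card-inj k suc Fin.suc-injective (λ { zero (_ , ne) → ⊥-elim (ne refl) ; (suc y) _ → y , refl })
        (card-ext k (λ x q → q , λ ()) (λ x → proj₁) (card-count k (Q? ∘ suc))))
... | no nq = card-inj (suc k) suc Fin.suc-injective (λ { zero q → ⊥-elim (nq q) ; (suc y) _ → y , refl })
        (card-count (suc k) (Q? ∘ suc))

count-mono : ∀ {n} {Q Q′ : Fin n → Set} (Q? : Decidable Q) (Q′? : Decidable Q′) →
             (∀ i → Q i → Q′ i) → count Q? ≤ count Q′?
count-mono {zero}  Q? Q′? f = z≤n
count-mono {suc n} Q? Q′? f with Q? zero | Q′? zero
... | yes q | yes _  = s≤s (count-mono (Q? ∘ suc) (Q′? ∘ suc) (f ∘ suc))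
... | yes q | no ¬q′ = ⊥-elim (¬q′ (f zero q))
... | no _  | yes _  = m≤n⇒m≤1+n (count-mono (Q? ∘ suc) (Q′? ∘ suc) (f ∘ suc))
... | no _  | no _   = count-mono (Q? ∘ suc) (Q′? ∘ suc) (f ∘ suc)

count-split : ∀ {n} {Q Q′ : Fin n → Set} (Q? : Decidable Q) (Q′? : Decidable Q′) →
              count Q? ≤ count (λ i → Q? i ×-dec Q′? i) + count (λ i → Q? i ×-dec ¬? (Q′? i))
count-split {zero}  Q? Q′? = z≤n
count-split {suc n} Q? Q′? with Q? zero | Q′? zero
... | yes _ | yes _ = s≤s (count-split (Q? ∘ suc) (Q′? ∘ suc))
... | yes _ | no _  = ≤-trans (s≤s (count-split (Q? ∘ suc) (Q′? ∘ suc))) (≤-reflexive (sym (+-suc _ _)))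
... | no _  | yes _ = count-split (Q? ∘ suc) (Q′? ∘ suc)
... | no _  | no _  = count-split (Q? ∘ suc) (Q′? ∘ suc)

count-∃ : ∀ {n} {Q : Fin n → Set} (Q? : Decidable Q) → 0 < count Q? → ∃ Q
count-∃ {suc n} Q? l with Q? zero
... | yes q = zero , q
... | no _ with i , q ← count-∃ (Q? ∘ suc) l = suc i , q

count-all : ∀ {n} {Q : Fin n → Set} (Q? : Decidable Q) → (∀ i → Q i) → n ≤ count Q?
count-all {zero}  Q? f = z≤n
count-all {suc n} Q? f with Q? zero
... | yes _ = s≤s (count-all (Q? ∘ suc) (f ∘ suc))
... | no ¬q = ⊥-elim (¬q (f zero))

count-punchIn : ∀ {n} {Q : Fin (suc n) → Set} (Q? : Decidable Q) i →
                count Q? ≤ suc (count (Q? ∘ punchIn i))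
count-punchIn Q? zero with Q? zero
... | yes _ = ≤-refl
... | no _  = n≤1+n _
count-punchIn {suc n} Q? (suc i) with Q? zero
... | yes _ = s≤s (count-punchIn (Q? ∘ suc) i)
... | no _  = count-punchIn (Q? ∘ suc) i

pigeonhole : ∀ {C : Set} (_≟_ : DecidableEquality C) N (cs : List C) {n} {T : Fin n → Set} (T? : Decidable T)
             (c : Fin n → C) → (∀ i → T i → c i ∈ cs) → length cs * N < count T? →
             ∃[ v ] N < count (λ i → T? i ×-dec (c i ≟ v))
pigeonhole _≟_ N [] T? c cov l with i , t ← count-∃ T? l with () ← cov i t
pigeonhole _≟_ N (x ∷ cs) {T = T} T? c cov l
  with N <? count (λ i → T? i ×-dec (c i ≟ x))
... | yes p = x , p
... | no ¬p with v , q ← pigeonhole _≟_ N cs (λ i → T? i ×-dec ¬? (c i ≟ x)) c (λ i (t , ne) → tail ne (cov i t))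
      (+-cancelˡ-< N _ _ (<-≤-trans l (≤-trans (count-split T? (λ i → c i ≟ x)) (+-monoˡ-≤ _ (≮⇒≥ ¬p)))))
  = v , <-≤-trans q (count-mono _ (λ i → T? i ×-dec (c i ≟ v)) λ i ((t , _) , e) → t , e)

-- Ehrenfeucht–Fraïssé games

Rel : Set → Set → Set₁
Rel X Y = X → Y → Set

Free : Rel X Y → (X → Set) → X → Set
Free R Q x = Q x × (∀ y → ¬ R x y)

_∪⟨_,_⟩ : Rel X Y → X → Y → Rel X Y
(R ∪⟨ x , y ⟩) x′ y′ = R x′ y′ ⊎ (x′ ≡ x × y′ ≡ y)

free-remove : ∀ k {t x y} (R : Rel X Y) {R′ : Rel X Y} {Q : X → Set} →
              (∀ {a b} → R a b → R′ a b) → (∀ {a b} → R′ a b → R a b ⊎ a ≡ x) → R′ x y →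
              Card k (Free R Q ∖ x) t → Card k (Free R′ Q) t
free-remove k {x = x} {y} R {R′} {Q} incl cases r = card-ext k to from
  where
  to : ∀ a → (Free R Q ∖ x) a → Free R′ Q a
  to a ((q , f) , ne) = q , λ b r′ → case-of (cases r′)
    where case-of : ∀ {b} → R a b ⊎ a ≡ x → ⊥
          case-of (inj₁ r₁) = f _ r₁
          case-of (inj₂ e)  = ne e
  from : ∀ a → Free R′ Q a → (Free R Q ∖ x) a
  from a (q , f) = (q , λ b → f b ∘ incl) , λ { refl → f _ r }

free-keep : ∀ k {t x} (R : Rel X Y) {R′ : Rel X Y} {Q : X → Set} →
            (∀ {a b} → R a b → R′ a b) → (∀ {a b} → R′ a b → R a b ⊎ a ≡ x) → ¬ Q x →
            Card k (Free R Q) t → Card k (Free R′ Q) t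
free-keep k {x = x} R {R′} {Q} incl cases ¬q = card-ext k to from
  where
  to : ∀ a → Free R Q a → Free R′ Q a
  to a (q , f) = q , λ b r′ → case-of (cases r′)
    where case-of : ∀ {b} → R a b ⊎ a ≡ x → ⊥
          case-of (inj₁ r₁)   = f _ r₁
          case-of (inj₂ refl) = ¬q q
  from : ∀ a → Free R′ Q a → Free R Q a
  from a (q , f) = q , λ b → f b ∘ incl

module _ (R : Rel X Y) {x : X} {y : Y} where

  ∪-fun : (∀ {a b c} → R a b → R a c → b ≡ c) → (∀ b → ¬ R x b) →
          ∀ {a b c} → (R ∪⟨ x , y ⟩) a b → (R ∪⟨ x , y ⟩) a c → b ≡ c
  ∪-fun f free (inj₁ r)             (inj₁ s)             = f r s
  ∪-fun f free (inj₁ r)             (inj₂ (refl , refl)) = ⊥-elim (free _ r)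
  ∪-fun f free (inj₂ (refl , refl)) (inj₁ s)             = ⊥-elim (free _ s)
  ∪-fun f free (inj₂ (refl , refl)) (inj₂ (_ , refl))    = refl

  ∪-inj : (∀ {a b c} → R b a → R c a → b ≡ c) → (∀ b → ¬ R b y) →
          ∀ {a b c} → (R ∪⟨ x , y ⟩) b a → (R ∪⟨ x , y ⟩) c a → b ≡ c
  ∪-inj f free (inj₁ r)             (inj₁ s)             = f r s
  ∪-inj f free (inj₁ r)             (inj₂ (refl , refl)) = ⊥-elim (free _ r)
  ∪-inj f free (inj₂ (refl , refl)) (inj₁ s)             = ⊥-elim (free _ s)
  ∪-inj f free (inj₂ (refl , refl)) (inj₂ (refl , _))    = refl

  ∪-cases : ∀ {a b} → (R ∪⟨ x , y ⟩) a b → R a b ⊎ a ≡ x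
  ∪-cases (inj₁ r)       = inj₁ r
  ∪-cases (inj₂ (e , _)) = inj₂ e

  ∪-cases′ : ∀ {a b} → (R ∪⟨ x , y ⟩) a b → R a b ⊎ b ≡ y
  ∪-cases′ (inj₁ r)       = inj₁ r
  ∪-cases′ (inj₂ (_ , e)) = inj₂ e

card-pick : ∀ k {t x} {Q : X → Set} {Q′ : Y → Set} → Q x → Card (suc k) Q t → Card (suc k) Q′ t →
            ∃[ t′ ] Card k (Q ∖ x) t′ × ¬ ¬ (∃[ y ] Q′ y × Card k (Q′ ∖ y) t′)
card-pick k {zero}  {x} q c       c′        = ⊥-elim (c x q)
card-pick k {suc t} {x} q (e , c) (e′ , c′) =
  t , c x q , λ κ → e′ λ (y , q′) → κ (y , q′ , c′ y q′)

module EF {T Act : Set} (_≟T_ : DecidableEquality T) (_≟A_ : DecidableEquality Act)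
          (cnt : T → Act → ℕ) (B : ℕ) where

  record Structure : Set₁ where
    field
      {Proc Pos} : Set
      _≟P_ : DecidableEquality Proc
      type : Proc → T
      label : Pos → Act
      proc : Pos → Proc

    At : Proc → Act → Pos → Set
    At p a x = label x ≡ a × proc x ≡ p

    field
      counts : ∀ p a → Card B (At p a) (cnt (type p) a)

    Domain : Set
    Domain = Pos ⊎ Proc

  open Structure

  -- The invariant of the Ehrenfeucht–Fraïssé game: π and μ match the pebbled
  -- processes and positions, and i more positions and j more processes can be
  -- matched.  A pebbled position has its process pebbled as well.
  record Match (𝒳 𝒴 : Structure) (i j : ℕ)
               (π : Rel (Proc 𝒳) (Proc 𝒴)) (μ : Rel (Pos 𝒳) (Pos 𝒴)) : Set where
    field
      π-type : ∀ {p q} → π p q → type 𝒳 p ≡ type 𝒴 q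
      π-fun  : ∀ {p q q′} → π p q → π p q′ → q ≡ q′
      π-inj  : ∀ {q p p′} → π p q → π p′ q → p ≡ p′
      μ-label : ∀ {x y} → μ x y → label 𝒳 x ≡ label 𝒴 y
      μ-proc : ∀ {x y} → μ x y → π (proc 𝒳 x) (proc 𝒴 y)
      μ-fun  : ∀ {x y y′} → μ x y → μ x y′ → y ≡ y′
      μ-inj  : ∀ {y x x′} → μ x y → μ x′ y → x ≡ x′
      positions : ∀ {p q} → π p q → ∀ a →
        ∃[ t ] Card i (Free μ (At 𝒳 p a)) t × Card i (Free (flip μ) (At 𝒴 q a)) t
      processes : ∀ τ →
        ∃[ t ] Card j (Free π λ p → type 𝒳 p ≡ τ) t × Card j (Free (flip π) λ q → type 𝒴 q ≡ τ) t

  open Match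

  module _ {𝒳 𝒴 : Structure} where

    match-sym : ∀ {i j π μ} → Match 𝒳 𝒴 i j π μ → Match 𝒴 𝒳 i j (flip π) (flip μ)
    match-sym m = record
      { π-type = sym ∘ π-type m ; π-fun = π-inj m ; π-inj = π-fun m
      ; μ-label = sym ∘ μ-label m ; μ-proc = μ-proc m ; μ-fun = μ-inj m ; μ-inj = μ-fun m
      ; positions = λ r a → let t , c , c′ = positions m r a in t , c′ , c
      ; processes = λ τ → let t , c , c′ = processes m τ in t , c′ , c }

    match-weaken : ∀ {i i′ j j′ π μ} → i′ ≤ i → j′ ≤ j → Match 𝒳 𝒴 i j π μ → Match 𝒳 𝒴 i′ j′ π μ
    match-weaken l l′ m = record
      { Match m
      ; positions = λ r a → let t , c , c′ = positions m r a in t , card-weaken l c , card-weaken l c′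
      ; processes = λ τ → let t , c , c′ = processes m τ in t , card-weaken l′ c , card-weaken l′ c′ }

    Extension : ℕ → ℕ → Rel (Proc 𝒳) (Proc 𝒴) → Rel (Pos 𝒳) (Pos 𝒴) →
                (Rel (Proc 𝒳) (Proc 𝒴) → Rel (Pos 𝒳) (Pos 𝒴) → Set) → Set₁
    Extension i j π μ Goal = ∃[ π′ ] ∃[ μ′ ]
      (∀ {p q} → π p q → π′ p q) × (∀ {x y} → μ x y → μ′ x y) × Match 𝒳 𝒴 i j π′ μ′ × Goal π′ μ′

    -- Equal numbers of free processes of each type, up to `suc j`, provide a partner. Pebbled
    -- positions have pebbled processes, so all positions of the new pair are still free, and the
    -- counts fixed by the common type, valid up to `B`, become its supply.
    extend-process : ∀ {i j π μ} → i ≤ B → Match 𝒳 𝒴 i (suc j) π μ → ∀ p →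
                     ¬ ¬ (Extension i j π μ λ π′ _ → ∃[ q ] π′ p q)
    extend-process {i} {j} {π} {μ} i≤B m p κ = ¬¬-excluded-middle {A = ∃[ q ] π p q} λ
      { (yes (q , r)) → κ (π , μ , id , id , match-weaken ≤-refl (n≤1+n j) m , q , r)
      ; (no fresh) →
        let t , c , c′ = processes m (type 𝒳 p)
            t′ , d , pick = card-pick j (refl , λ q r → fresh (q , r)) c c′
        in pick λ (q , (e , fresh′) , d′) → κ
          (π ∪⟨ p , q ⟩ , μ , inj₁ , id , add t′ d q e fresh′ d′ (λ q r → fresh (q , r)) , q , inj₂ (refl , refl)) }
      where
      add : ∀ t′ → Card j (Free π (λ p′ → type 𝒳 p′ ≡ type 𝒳 p) ∖ p) t′ →
            ∀ q → type 𝒴 q ≡ type 𝒳 p → (∀ p′ → ¬ π p′ q) →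
            Card j (Free (flip π) (λ q′ → type 𝒴 q′ ≡ type 𝒳 p) ∖ q) t′ →
            (∀ q′ → ¬ π p q′) → Match 𝒳 𝒴 i j (π ∪⟨ p , q ⟩) μ
      add t′ d q e fresh′ d′ fresh = record
        { π-type = λ { (inj₁ r) → π-type m r ; (inj₂ (refl , refl)) → sym e }
        ; π-fun  = ∪-fun π (π-fun m) fresh
        ; π-inj  = ∪-inj π (π-inj m) fresh′
        ; μ-label = μ-label m
        ; μ-proc = inj₁ ∘ μ-proc m
        ; μ-fun  = μ-fun m
        ; μ-inj  = μ-inj m
        ; positions = pos
        ; processes = prc }
        where
        pos : ∀ {p′ q′} → (π ∪⟨ p , q ⟩) p′ q′ → ∀ a →
              ∃[ t ] Card i (Free μ (At 𝒳 p′ a)) t × Card i (Free (flip μ) (At 𝒴 q′ a)) t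
        pos (inj₁ r) a = positions m r a
        pos (inj₂ (refl , refl)) a =
          cnt (type 𝒳 p) a ,
          card-ext i (λ { x (e , refl) → (e , refl) , λ y u → fresh _ (μ-proc m u) }) (λ _ → proj₁)
            (card-weaken i≤B (counts 𝒳 p a)) ,
          card-ext i (λ { x (e , refl) → (e , refl) , λ y u → fresh′ _ (μ-proc m u) }) (λ _ → proj₁)
            (card-weaken i≤B (subst (λ τ → Card B (At 𝒴 q a) (cnt τ a)) e (counts 𝒴 q a)))
        prc : ∀ τ → ∃[ t ] Card j (Free (π ∪⟨ p , q ⟩) λ p → type 𝒳 p ≡ τ) t
                         × Card j (Free (flip (π ∪⟨ p , q ⟩)) λ q → type 𝒴 q ≡ τ) t
        prc τ with type 𝒳 p ≟T τ
        ... | yes refl = t′ , free-remove j π inj₁ (∪-cases π) (inj₂ (refl , refl)) d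
                            , free-remove j (flip π) inj₁ (∪-cases′ π) (inj₂ (refl , refl)) d′
        ... | no ne = let t , c , c′ = processes m τ in
          t , free-keep j π inj₁ (∪-cases π) ne (card-weaken (n≤1+n j) c)
            , free-keep j (flip π) inj₁ (∪-cases′ π) (λ e′ → ne (trans (sym e) e′)) (card-weaken (n≤1+n j) c′)

    -- The process of `x` is paired already, so a partner is sought only among the free positions of
    -- `q` with the same label. Only the supply of this process and label shrinks.
    extend-position : ∀ {i j π μ} → Match 𝒳 𝒴 (suc i) j π μ → ∀ x {q} → π (proc 𝒳 x) q →
                      ¬ ¬ (Extension i j π μ λ _ μ′ → ∃[ y ] μ′ x y)
    extend-position {i} {j} {π} {μ} m x {q} r κ = ¬¬-excluded-middle {A = ∃[ y ] μ x y} λ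
      { (yes (y , u)) → κ (π , μ , id , id , match-weaken (n≤1+n i) ≤-refl m , y , u)
      ; (no fresh) →
        let t , c , c′ = positions m r (label 𝒳 x)
            t′ , d , pick = card-pick i ((refl , refl) , λ y u → fresh (y , u)) c c′
        in pick λ (y , (e , fresh′) , d′) → κ
          (π , μ ∪⟨ x , y ⟩ , id , inj₁ , add t′ d y e fresh′ d′ (λ y u → fresh (y , u)) , y , inj₂ (refl , refl)) }
      where
      add : ∀ t′ → Card i (Free μ (At 𝒳 (proc 𝒳 x) (label 𝒳 x)) ∖ x) t′ →
            ∀ y → At 𝒴 q (label 𝒳 x) y → (∀ x′ → ¬ μ x′ y) →
            Card i (Free (flip μ) (At 𝒴 q (label 𝒳 x)) ∖ y) t′ →
            (∀ y′ → ¬ μ x y′) → Match 𝒳 𝒴 i j π (μ ∪⟨ x , y ⟩)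
      add t′ d y (e , refl) fresh′ d′ fresh = record
        { π-type = π-type m
        ; π-fun  = π-fun m
        ; π-inj  = π-inj m
        ; μ-label = λ { (inj₁ u) → μ-label m u ; (inj₂ (refl , refl)) → sym e }
        ; μ-proc = λ { (inj₁ u) → μ-proc m u ; (inj₂ (refl , refl)) → r }
        ; μ-fun  = ∪-fun μ (μ-fun m) fresh
        ; μ-inj  = ∪-inj μ (μ-inj m) fresh′
        ; positions = pos
        ; processes = processes m }
        where
        pos : ∀ {p′ q′} → π p′ q′ → ∀ a →
              ∃[ t ] Card i (Free (μ ∪⟨ x , y ⟩) (At 𝒳 p′ a)) t × Card i (Free (flip (μ ∪⟨ x , y ⟩)) (At 𝒴 q′ a)) t
        pos {p′} {q′} r′ a with label 𝒳 x ≟A a | _≟P_ 𝒳 (proc 𝒳 x) p′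
        ... | yes refl | yes refl with refl ← π-fun m r r′
          = t′ , free-remove i μ inj₁ (∪-cases μ) (inj₂ (refl , refl)) d
               , free-remove i (flip μ) inj₁ (∪-cases′ μ) (inj₂ (refl , refl)) d′
        ... | no ne | _ = let t , c , c′ = positions m r′ a in
          t , free-keep i μ inj₁ (∪-cases μ) (ne ∘ proj₁) (card-weaken (n≤1+n i) c)
            , free-keep i (flip μ) inj₁ (∪-cases′ μ) (λ (e′ , _) → ne (trans (sym e) e′)) (card-weaken (n≤1+n i) c′)
        ... | _ | no ne = let t , c , c′ = positions m r′ a in
          t , free-keep i μ inj₁ (∪-cases μ) (ne ∘ proj₂) (card-weaken (n≤1+n i) c)
            , free-keep i (flip μ) inj₁ (∪-cases′ μ) (λ (_ , e′) → ne (π-inj m (subst (π _) e′ r) r′)) (card-weaken (n≤1+n i) c′)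

    Paired : Rel (Proc 𝒳) (Proc 𝒴) → Rel (Pos 𝒳) (Pos 𝒴) → Domain 𝒳 → Domain 𝒴 → Set
    Paired π μ (inj₁ x) (inj₁ y) = μ x y
    Paired π μ (inj₂ p) (inj₂ q) = π p q
    Paired π μ _        _        = ⊥

    paired-mono : ∀ {π π′ : Rel (Proc 𝒳) (Proc 𝒴)} {μ μ′ : Rel (Pos 𝒳) (Pos 𝒴)} →
                  (∀ {p q} → π p q → π′ p q) → (∀ {x y} → μ x y → μ′ x y) →
                  ∀ d e → Paired π μ d e → Paired π′ μ′ d e
    paired-mono f g (inj₁ x) (inj₁ y) = g
    paired-mono f g (inj₂ p) (inj₂ q) = f

    -- Pebbling a position may require pebbling its process first, so one round can cost a unit of
    -- both supplies. This is why both of them start at `B`.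
    reply : ∀ {k π μ} → suc k ≤ B → Match 𝒳 𝒴 (suc k) (suc k) π μ → ∀ d →
            ¬ ¬ (Extension k k π μ λ π′ μ′ → ∃[ e ] Paired π′ μ′ d e)
    reply l m (inj₁ x) κ = extend-process l m (proc 𝒳 x) λ (π₁ , μ₁ , f₁ , g₁ , m₁ , q , r) →
      extend-position m₁ x r λ (π₂ , μ₂ , f₂ , g₂ , m₂ , y , u) →
        κ (π₂ , μ₂ , f₂ ∘ f₁ , g₂ ∘ g₁ , m₂ , inj₁ y , u)
    reply l m (inj₂ p) κ = extend-process l m p λ (π₁ , μ₁ , f₁ , g₁ , m₁ , q , r) →
      κ (π₁ , μ₁ , f₁ , g₁ , match-weaken (n≤1+n _) ≤-refl m₁ , inj₂ q , r)

    match-empty : (∀ τ → ∃[ t ] Card B (λ p → type 𝒳 p ≡ τ) t × Card B (λ q → type 𝒴 q ≡ τ) t) →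
                  Match 𝒳 𝒴 B B (λ _ _ → ⊥) (λ _ _ → ⊥)
    match-empty h = record
      { π-type = λ () ; π-fun = λ () ; π-inj = λ () ; μ-label = λ () ; μ-proc = λ () ; μ-fun = λ () ; μ-inj = λ ()
      ; positions = λ ()
      ; processes = λ τ → let t , c , c′ = h τ in
          t , card-ext B (λ _ e → e , λ _ ()) (λ _ → proj₁) c , card-ext B (λ _ e → e , λ _ ()) (λ _ → proj₁) c′ }

-- Data words as structures

record Finite (X : Set) : Set where
  field
    elements : List X
    complete : ∀ x → x ∈ elements

  any : ∀ {Q : X → Set} → Decidable Q → Dec (∃ Q)
  any Q? = map′ (λ a → let x , _ , q = find a in x , q) (λ (x , q) → lose (complete x) q) (any? Q? elements)

  all : ∀ {Q : X → Set} → Decidable Q → Dec (∀ x → Q x)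
  all Q? = map′ (λ f x → decidable-stable (Q? x) λ ¬q → f (x , ¬q)) (λ f (x , ¬q) → ¬q (f x)) (¬? (any (¬? ∘ Q?)))

open Finite using (any; all; elements; complete)

finite-Fin : ∀ n → Finite (Fin n)
finite-Fin n = record { elements = allFin n ; complete = ∈-allFin }

finite-× : ∀ {X Y} → Finite X → Finite Y → Finite (X × Y)
finite-× F G = record
  { elements = cartesianProduct (elements F) (elements G)
  ; complete = λ (x , y) → ∈-cartesianProduct⁺ (complete F x) (complete G y) }

finite-⊎ : ∀ {X Y} → Finite X → Finite Y → Finite (X ⊎ Y)
finite-⊎ F G = record
  { elements = List.map inj₁ (elements F) List.++ List.map inj₂ (elements G)
  ; complete = λ { (inj₁ x) → ∈-++⁺ˡ (∈-map⁺ inj₁ (complete F x))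
                 ; (inj₂ y) → ∈-++⁺ʳ (List.map inj₁ (elements F)) (∈-map⁺ inj₂ (complete G y)) } }

finite-Vec : ∀ {X} → Finite X → ∀ n → Finite (Vec X n)
finite-Vec F zero    = record { elements = [] ∷ [] ; complete = λ { [] → here refl } }
finite-Vec F (suc n) = record
  { elements = cartesianProductWith _∷_ (elements F) (elements (finite-Vec F n))
  ; complete = λ { (x ∷ xs) → ∈-cartesianProductWith⁺ _∷_ (complete F x) (complete (finite-Vec F n) xs) } }

rank : ∀ {A n} → Formula A n → ℕ
rank (act a x) = 0
rank (x ≐ y)   = 0
rank (x ∼ y)   = 0
rank (ℙS x)    = 0
rank (ℙE x)    = 0
rank (ℙSE x)   = 0
rank (¬′ φ)    = rank φ
rank (φ ∧′ ψ)  = rank φ ⊔ rank ψ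
rank (φ ∨′ ψ)  = rank φ ⊔ rank ψ
rank (∃′ φ)    = suc (rank φ)
rank (∀′ φ)    = suc (rank φ)

_≟E_ : ∀ {A} → DecidableEquality (Element A)
_≟E_ = Sum.≡-dec Fin._≟_ Fin._≟_

module Semantics {A P : FiniteSplit} where
  open Game A P

  infix 4 _≟L_
  _≟L_ : DecidableEquality Letter
  _≟L_ = Sum.≡-dec (Product.≡-dec Fin._≟_ Fin._≟_) (Product.≡-dec Fin._≟_ Fin._≟_)

  position≟ : ∀ w → DecidableEquality (Position w)
  position≟ (finite w)   = Fin._≟_
  position≟ (infinite w) = _≟_

  domain≟ : ∀ w → DecidableEquality (Domain w)
  domain≟ w = Sum.≡-dec (position≟ w) _≟E_

  module _ (w : DataWord) where

    act? : ∀ a (d : Domain w) → Dec (∃[ i ] d ≡ inj₁ i × action (letterAt w i) ≡ a)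
    act? a (inj₁ i) = map′ (λ e → i , refl , e) (λ { (_ , refl , e) → e }) (action (letterAt w i) ≟E a)
    act? a (inj₂ p) = no λ ()

    system? : (d : Domain w) → Dec (∃[ p ] d ≡ inj₂ (inj₁ p))
    system? (inj₁ i)        = no λ ()
    system? (inj₂ (inj₁ p)) = yes (p , refl)
    system? (inj₂ (inj₂ p)) = no λ ()

    environment? : (d : Domain w) → Dec (∃[ p ] d ≡ inj₂ (inj₂ p))
    environment? (inj₁ i)        = no λ ()
    environment? (inj₂ (inj₁ p)) = no λ ()
    environment? (inj₂ (inj₂ p)) = yes (p , refl)

    -- This lets objects that exist only classically, such as a reply in the game or a point of
    -- stabilisation, serve in proofs of satisfaction.
    ⊨-stable : ∀ {n} (φ : Formula A n) ρ → ¬ ¬ (w , ρ ⊨ φ) → w , ρ ⊨ φ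
    ⊨-stable (act a x) ρ s = decidable-stable (act? a (ρ x)) s
    ⊨-stable (x ≐ y)   ρ s = decidable-stable (domain≟ w (ρ x) (ρ y)) s
    ⊨-stable (x ∼ y)   ρ s = decidable-stable (processOf w (ρ x) ≟E processOf w (ρ y)) s
    ⊨-stable (ℙS x)    ρ s = decidable-stable (system? (ρ x)) s
    ⊨-stable (ℙE x)    ρ s = decidable-stable (environment? (ρ x)) s
    ⊨-stable (ℙSE x)   ρ s = s id
    ⊨-stable (¬′ φ)    ρ s h = s λ n → n h
    ⊨-stable (φ ∧′ ψ)  ρ s = ⊨-stable φ ρ (λ κ → s (κ ∘ proj₁)) , ⊨-stable ψ ρ (λ κ → s (κ ∘ proj₂))
    ⊨-stable (φ ∨′ ψ)  ρ s κ = s λ n → n κ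
    ⊨-stable (∃′ φ)    ρ s κ = s λ n → n κ
    ⊨-stable (∀′ φ)    ρ s d = ⊨-stable φ (d ∷ᶠ ρ) λ κ → s λ h → κ (h d)

  module _ (u : List Letter) where

    private
      w = finite u

    finite-Domain : Finite (Domain w)
    finite-Domain = finite-⊎ (finite-Fin _) (finite-⊎ (finite-Fin _) (finite-Fin _))

    ⊨? : ∀ {n} (φ : Formula A n) ρ → Dec (w , ρ ⊨ φ)
    ⊨? (act a x) ρ = act? w a (ρ x)
    ⊨? (x ≐ y)   ρ = domain≟ w (ρ x) (ρ y)
    ⊨? (x ∼ y)   ρ = processOf w (ρ x) ≟E processOf w (ρ y)
    ⊨? (ℙS x)    ρ = system? w (ρ x)
    ⊨? (ℙE x)    ρ = environment? w (ρ x)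
    ⊨? (ℙSE x)   ρ = no id
    ⊨? (¬′ φ)    ρ = ¬? (⊨? φ ρ)
    ⊨? (φ ∧′ ψ)  ρ = ⊨? φ ρ ×-dec ⊨? ψ ρ
    ⊨? (φ ∨′ ψ)  ρ = ¬? (¬? (⊨? φ ρ ⊎-dec ⊨? ψ ρ))
    ⊨? (∃′ φ)    ρ = ¬? (¬? (any finite-Domain λ d → ⊨? φ (d ∷ᶠ ρ)))
    ⊨? (∀′ φ)    ρ = all finite-Domain λ d → ⊨? φ (d ∷ᶠ ρ)

-- Transfer of sentences between data words

Counter : ℕ → ℕ → Set
Counter B a = Vec (Fin (suc B)) a

module Transfer (A : FiniteSplit) (B : ℕ) where

  -- The sum remembers the owner, so that paired process elements agree on `ℙS` and `ℙE`.
  Type : Set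
  Type = Counter B (sizeS A) ⊎ Counter B (sizeE A)

  _≟T_ : DecidableEquality Type
  _≟T_ = Sum.≡-dec (Vec.≡-dec Fin._≟_) (Vec.≡-dec Fin._≟_)

  cnt : Type → Element A → ℕ
  cnt (inj₁ v) (inj₁ a) = toℕ (Vec.lookup v a)
  cnt (inj₂ v) (inj₂ a) = toℕ (Vec.lookup v a)
  -- No process plays an action of the opponent.
  cnt _        _        = 0

  module EF′ = EF _≟T_ (_≟E_ {A}) cnt B
  open EF′

  record Profile (P : FiniteSplit) : Set where
    open Game A P
    field
      word        : DataWord
      system      : System P → Counter B (sizeS A)
      environment : Environment P → Counter B (sizeE A)
      profile-counts : ∀ p a → Card B (λ i → action (letterAt word i) ≡ a × process (letterAt word i) ≡ p)
                                 (cnt (Sum.map system environment p) a)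

    structure : Structure
    structure = record
      { _≟P_ = _≟E_ {P} ; type = Sum.map system environment
      ; label = λ i → action (letterAt word i) ; proc = λ i → process (letterAt word i) ; counts = profile-counts }

  open Profile
  open Match

  paired-sym : ∀ {𝒳 𝒴} {π : Rel (Structure.Proc 𝒳) (Structure.Proc 𝒴)} {μ : Rel (Structure.Pos 𝒳) (Structure.Pos 𝒴)} d e →
               Paired {𝒳} {𝒴} π μ d e → Paired {𝒴} {𝒳} (flip π) (flip μ) e d
  paired-sym (inj₁ _) (inj₁ _) r = r
  paired-sym (inj₂ _) (inj₂ _) r = r

  module _ {P P′ : FiniteSplit} (x : Profile P) (y : Profile P′) where
    private
      module G  = Game A P
      module G′ = Game A P′
      𝒳 = structure x
      𝒴 = structure y

    module _ {i j π μ} (m : Match 𝒳 𝒴 i j π μ) where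

      paired-act : ∀ {a} d e → Paired {𝒳} {𝒴} π μ d e →
                   (∃[ i ] d ≡ inj₁ i × G.action (G.letterAt (word x) i) ≡ a) →
                   ∃[ i ] e ≡ inj₁ i × G′.action (G′.letterAt (word y) i) ≡ a
      paired-act (inj₁ _) (inj₁ i′) r (_ , refl , eq) = i′ , refl , trans (sym (μ-label m r)) eq

      paired-≡ : ∀ d e d′ e′ → Paired {𝒳} {𝒴} π μ d e → Paired {𝒳} {𝒴} π μ d′ e′ → d ≡ d′ → e ≡ e′
      paired-≡ (inj₁ _) (inj₁ _) _ (inj₁ _) r r′ refl = cong inj₁ (μ-fun m r r′)
      paired-≡ (inj₂ _) (inj₂ _) _ (inj₂ _) r r′ refl = cong inj₂ (π-fun m r r′)

      paired-process : ∀ d e → Paired {𝒳} {𝒴} π μ d e → π (G.processOf (word x) d) (G′.processOf (word y) e)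
      paired-process (inj₁ _) (inj₁ _) r = μ-proc m r
      paired-process (inj₂ _) (inj₂ _) r = r

      paired-system : ∀ d e → Paired {𝒳} {𝒴} π μ d e → (∃[ p ] d ≡ inj₂ (inj₁ p)) → ∃[ p ] e ≡ inj₂ (inj₁ p)
      paired-system (inj₂ _) (inj₂ (inj₁ q)) r (_ , refl) = q , refl
      paired-system (inj₂ _) (inj₂ (inj₂ q)) r (_ , refl) with () ← π-type m r

      paired-environment : ∀ d e → Paired {𝒳} {𝒴} π μ d e → (∃[ p ] d ≡ inj₂ (inj₂ p)) → ∃[ p ] e ≡ inj₂ (inj₂ p)
      paired-environment (inj₂ _) (inj₂ (inj₂ q)) r (_ , refl) = q , refl
      paired-environment (inj₂ _) (inj₂ (inj₁ q)) r (_ , refl) with () ← π-type m r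

  -- One direction is enough: negation and the replies for `∀′` exchange the two words, which the
  -- symmetric invariant allows. A quantifier spends one round, so `k` only has to dominate the rank
  -- of what is left.
  transfer : ∀ {P P′} (x : Profile P) (y : Profile P′) {k n π μ} (φ : Formula A n) {ρ ρ′} →
             rank φ ≤ k → k ≤ B → Match (structure x) (structure y) k k π μ →
             (∀ i → Paired {structure x} {structure y} π μ (ρ i) (ρ′ i)) →
             Game._,_⊨_ A P (word x) ρ φ → Game._,_⊨_ A P′ (word y) ρ′ φ
  transfer x y (act a v) l l′ m r h = paired-act x y m _ _ (r v) h
  transfer x y (v ≐ v′)  l l′ m r h = paired-≡ x y m _ _ _ _ (r v) (r v′) h
  transfer x y {π = π} (v ∼ v′) {ρ} {ρ′} l l′ m r h = π-fun m (paired-process x y m (ρ v) (ρ′ v) (r v))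
    (subst (λ p → π p (Game.processOf A _ (word y) (ρ′ v′))) (sym h)
      (paired-process x y m (ρ v′) (ρ′ v′) (r v′)))
  transfer x y (ℙS v)    l l′ m r h = paired-system x y m _ _ (r v) h
  transfer x y (ℙE v)    l l′ m r h = paired-environment x y m _ _ (r v) h
  transfer x y {π = π} {μ} (¬′ φ) {ρ} {ρ′} l l′ m r h h′ =
    h (transfer y x φ l l′ (match-sym m) (λ i → paired-sym {structure x} {structure y} {π} {μ} (ρ i) (ρ′ i) (r i)) h′)
  transfer x y (φ ∧′ ψ)  l l′ m r (h , h′) =
    transfer x y φ (m⊔n≤o⇒m≤o _ _ l) l′ m r h , transfer x y ψ (m⊔n≤o⇒n≤o _ _ l) l′ m r h′
  transfer x y (φ ∨′ ψ)  l l′ m r h κ = h λ where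
    (inj₁ t) → κ (inj₁ (transfer x y φ (m⊔n≤o⇒m≤o _ _ l) l′ m r t))
    (inj₂ t) → κ (inj₂ (transfer x y ψ (m⊔n≤o⇒n≤o _ _ l) l′ m r t))
  transfer x y (∃′ φ) {ρ} {ρ′} (s≤s l) l′ m r h κ = h λ (d , t) → reply l′ m d
    λ (π′ , μ′ , f , g , m′ , e , r₀) → κ (e , transfer x y φ l (<⇒≤ l′) m′
      (λ { zero → r₀ ; (suc i) → paired-mono {structure x} {structure y} f g (ρ i) (ρ′ i) (r i) }) t)
  transfer {P′ = P′} x y (∀′ φ) {ρ} {ρ′} (s≤s l) l′ m r h e = Semantics.⊨-stable (word y) φ (e ∷ᶠ ρ′) λ κ →
    reply l′ (match-sym m) e
    λ (π′ , μ′ , f , g , m′ , d , r₀) → κ (transfer x y φ l (<⇒≤ l′) (match-sym m′)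
      (λ { zero → paired-sym {structure y} {structure x} {π′} {μ′} e d r₀
         ; (suc i) → paired-mono {structure x} {structure y} f g (ρ i) (ρ′ i) (r i) }) (h d))

  transfer-sentence : ∀ {P P′} (x : Profile P) (y : Profile P′) (φ : Sentence A) → rank φ ≤ B →
    (∀ τ → ∃[ t ] Card B (λ p → Sum.map (system x) (environment x) p ≡ τ) t
                × Card B (λ p → Sum.map (system y) (environment y) p ≡ τ) t) →
    Game._⊨_ A P (word x) φ → Game._⊨_ A P′ (word y) φ
  transfer-sentence x y φ l h = transfer x y φ l ≤-refl (match-empty {structure x} {structure y} h) λ ()

-- Configurations

weigh : ∀ {X : Set} → (X → ℕ) → Vec X n → ℕ
weigh w xs = Vec.sum (Vec.map w xs)

weigh-bound : ∀ {X : Set} {w : X → ℕ} {b} → (∀ x → w x ≤ b) → (xs : Vec X n) → weigh w xs ≤ n * b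
weigh-bound l []       = z≤n
weigh-bound l (x ∷ xs) = +-mono-≤ (l x) (weigh-bound l xs)

-- The dichotomy "idle or raises a bounded potential" is lifted from capped numbers to counters,
-- teams and configurations. It yields both the stabilisation of infinite words and the length of
-- the finite game.
weigh-updateAt : ∀ {X : Set} {w : X → ℕ} {f : X → X} → (∀ x → f x ≡ x ⊎ w x < w (f x)) →
                 ∀ (xs : Vec X n) i → Vec.updateAt xs i f ≡ xs ⊎ weigh w xs < weigh w (Vec.updateAt xs i f)
weigh-updateAt h (x ∷ xs) zero =
  Sum.map (cong (_∷ xs)) (+-monoˡ-< _) (h x)
weigh-updateAt h (x ∷ xs) (suc i) =
  Sum.map (cong (x ∷_)) (+-monoʳ-< _) (weigh-updateAt h xs i)

⊓-absorb : ∀ b m o → b ⊓ (b ⊓ m + o) ≡ b ⊓ (m + o)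
⊓-absorb b m o with ≤-total m b
... | inj₁ l rewrite m≥n⇒m⊓n≡n l = refl
... | inj₂ l rewrite m≤n⇒m⊓n≡m l | m≤n⇒m⊓n≡m (m≤m+n b o) = sym (m≤n⇒m⊓n≡m (≤-trans l (m≤m+n m o)))

card-empty : ∀ k {X : Set} {Q : X → Set} → (∀ x → ¬ Q x) → Card k Q 0
card-empty zero    h = tt
card-empty (suc k) h = h

card-⊓ : ∀ k {t} {X : Set} {Q : X → Set} → Card k Q t → Card k Q (k ⊓ t)
card-⊓ k {t} c with ≤-total t k
... | inj₁ l rewrite m≥n⇒m⊓n≡n l = c
... | inj₂ l rewrite m≤n⇒m⊓n≡m l = card-cap k l ≤-refl c

capSuc : ∀ {B} → Fin (suc B) → Fin (suc B)
capSuc {zero}  zero    = zero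
capSuc {suc B} zero    = suc zero
capSuc {suc B} (suc i) = suc (capSuc i)

toℕ-capSuc : ∀ {B} (i : Fin (suc B)) → toℕ (capSuc i) ≡ B ⊓ suc (toℕ i)
toℕ-capSuc {zero}  zero    = refl
toℕ-capSuc {suc B} zero    = cong suc (sym (⊓-zeroʳ B))
toℕ-capSuc {suc B} (suc i) = cong suc (toℕ-capSuc i)

capSuc-grows : ∀ {B} (i : Fin (suc B)) → capSuc i ≡ i ⊎ toℕ i < toℕ (capSuc i)
capSuc-grows {zero}  zero    = inj₁ refl
capSuc-grows {suc B} zero    = inj₂ (s≤s z≤n)
capSuc-grows {suc B} (suc i) = Sum.map (cong suc) s≤s (capSuc-grows i)

module Configuration (B : ℕ) where

  increment : Fin a → Counter B a → Counter B a
  increment i v = Vec.updateAt v i capSuc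

  height : Counter B a → ℕ
  height = weigh toℕ

  increment-grows : ∀ i (v : Counter B a) → increment i v ≡ v ⊎ height v < height (increment i v)
  increment-grows i v = weigh-updateAt capSuc-grows v i

  height-bound : (v : Counter B a) → height v ≤ a * B
  height-bound = weigh-bound (λ i → Fin.toℕ≤pred[n] i)

  Team : ℕ → ℕ → Set
  Team a n = Vec (Counter B a) n

  _≟C_ : DecidableEquality (Counter B a)
  _≟C_ = Vec.≡-dec Fin._≟_

  finite-Team : ∀ a n → Finite (Team a n)
  finite-Team a n = finite-Vec (finite-Vec (finite-Fin _) a) n

  move : Team a n → Fin a × Fin n → Team a n
  move c (i , p) = Vec.updateAt c p (increment i)

  altitude : Team a n → ℕ
  altitude = weigh height

  move-grows : ∀ (c : Team a n) x → move c x ≡ c ⊎ altitude c < altitude (move c x)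
  move-grows c (i , p) = weigh-updateAt (increment-grows i) c p

  altitude-bound : (c : Team a n) → altitude c ≤ n * (a * B)
  altitude-bound = weigh-bound height-bound

  start : Team a n
  start {a} {n} = Vec.replicate n (Vec.replicate a zero)

  entry : Team a n → Fin a × Fin n → ℕ
  entry c (i , p) = toℕ (Vec.lookup (Vec.lookup c p) i)

  entry-bound : ∀ (c : Team a n) x → entry c x ≤ B
  entry-bound c (i , p) = Fin.toℕ≤pred[n] _

  entry-start : ∀ x → entry (start {a} {n}) x ≡ 0
  entry-start (i , p) = cong toℕ
    (trans (cong (λ v → Vec.lookup v i) (Vec.lookup-replicate p (Vec.replicate _ zero))) (Vec.lookup-replicate i zero))

  entry-move : ∀ (c : Team a n) x → entry (move c x) x ≡ B ⊓ suc (entry c x)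
  entry-move c (i , p)
    rewrite Vec.lookup∘updateAt p {increment i} c | Vec.lookup∘updateAt i {capSuc} (Vec.lookup c p) = toℕ-capSuc _

  entry-move-≢ : ∀ (c : Team a n) {x y} → x ≢ y → entry (move c x) y ≡ entry c y
  entry-move-≢ c {i , p} {j , q} ne with q Fin.≟ p
  ... | no q≢p rewrite Vec.lookup∘updateAt′ q p {increment i} q≢p c = refl
  ... | yes refl rewrite Vec.lookup∘updateAt p {increment i} c =
    cong toℕ (Vec.lookup∘updateAt′ j i (λ { refl → ne refl }) (Vec.lookup c p))

  lookup-ext : ∀ {X : Set} {xs ys : Vec X n} → (∀ i → Vec.lookup xs i ≡ Vec.lookup ys i) → xs ≡ ys
  lookup-ext {xs = xs} {ys} h =
    trans (sym (Vec.tabulate∘lookup xs)) (trans (Vec.tabulate-cong h) (Vec.tabulate∘lookup ys))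

  entry-injective : ∀ {c c′ : Team a n} → (∀ x → entry c x ≡ entry c′ x) → c ≡ c′
  entry-injective h = lookup-ext λ p → lookup-ext λ i → Fin.toℕ-injective (h (i , p))

  infix 4 _⊑_ _⊑?_ _~_

  _⊑_ : Team a n → Team a n → Set
  c ⊑ c′ = ∀ x → entry c x ≤ entry c′ x

  _⊑?_ : ∀ (c c′ : Team a n) → Dec (c ⊑ c′)
  c ⊑? c′ = Finite.all (finite-× (finite-Fin _) (finite-Fin _)) λ x → entry c x ≤? entry c′ x

  ⊑-refl : {c : Team a n} → c ⊑ c
  ⊑-refl x = ≤-refl

  ⊑-trans : {c d e : Team a n} → c ⊑ d → d ⊑ e → c ⊑ e
  ⊑-trans f g x = ≤-trans (f x) (g x)

  move-⊒ : ∀ (c : Team a n) x → c ⊑ move c x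
  move-⊒ c x y with Product.≡-dec Fin._≟_ Fin._≟_ x y
  ... | yes refl = ≤-trans (⊓-glb (entry-bound c x) (n≤1+n _)) (≤-reflexive (sym (entry-move c x)))
  ... | no ne    = ≤-reflexive (sym (entry-move-≢ c ne))

  move-⊑ : ∀ {c c′ : Team a n} {x} → c ⊑ c′ → entry c x < entry c′ x → move c x ⊑ c′
  move-⊑ {c = c} {c′} {x} h l y with Product.≡-dec Fin._≟_ Fin._≟_ x y
  ... | yes refl = ≤-trans (≤-reflexive (entry-move c x)) (≤-trans (m⊓n≤n B _) l)
  ... | no ne    = ≤-trans (≤-reflexive (entry-move-≢ c ne)) (h y)

  _~_ : Team a n → Team a n′ → Set
  c ~ c′ = ∀ v → ∃[ t ] Card B (λ p → Vec.lookup c p ≡ v) t × Card B (λ p → Vec.lookup c′ p ≡ v) t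

  ~-refl : (c : Team a n) → c ~ c
  ~-refl c v = _ , card-count B (λ p → Vec.lookup c p ≟C v) , card-count B (λ p → Vec.lookup c p ≟C v)

  -- The removed process leaves at least `B` others with its counter, so this class is capped before
  -- and after. All other classes are untouched.
  ~-drop : ∀ (c : Team a (suc n)) (c′ : Team a n) p → (∀ q → Vec.lookup c′ q ≡ Vec.lookup c (punchIn p q)) →
           B ≤ count (λ q → Vec.lookup c′ q ≟C Vec.lookup c p) → c ~ c′
  ~-drop c c′ p same l v with Vec.lookup c p ≟C v
  ... | yes refl = _ , card-cap B (m≤n⇒m≤1+n l) l (card-weaken (n≤1+n B) (card-insert Fin._≟_ B refl rest)) , here′
    where
    here′ = card-count B (λ q → Vec.lookup c′ q ≟C Vec.lookup c p)
    rest : Card B ((λ q → Vec.lookup c q ≡ Vec.lookup c p) ∖ p) (count (λ q → Vec.lookup c′ q ≟C Vec.lookup c p))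
    rest = card-inj B (punchIn p) (Fin.punchIn-injective p _ _)
      (λ q (_ , ne) → punchOut (ne ∘ sym) , Fin.punchIn-punchOut (ne ∘ sym))
      (card-ext B (λ q e → trans (sym (same q)) e , Fin.punchInᵢ≢i p q) (λ q (e , _) → trans (same q) e) here′)
  ... | no ne = _ ,
    card-inj B (punchIn p) (Fin.punchIn-injective p _ _)
      (λ q e → punchOut {i = p} {q} (λ { refl → ne e }) , Fin.punchIn-punchOut _)
      (card-ext B (λ q e → trans (sym (same q)) e) (λ q e → trans (same q) e) here′) , here′
    where
    here′ = card-count B (λ q → Vec.lookup c′ q ≟C v)

  -- Words and the configurations they realise

  module Words (A P : FiniteSplit) where
    open Game A P
    open Semantics {A} {P}

    Config : Set
    Config = Team (sizeS A) (sizeS P) × Team (sizeE A) (sizeE P)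

    step : Config → Letter → Config
    step (s , e) (inj₁ x) = move s x , e
    step (s , e) (inj₂ x) = s , move e x

    level : Config → Letter → ℕ
    level (s , e) (inj₁ x) = entry s x
    level (s , e) (inj₂ x) = entry e x

    level-bound : ∀ c σ → level c σ ≤ B
    level-bound (s , e) (inj₁ x) = entry-bound s x
    level-bound (s , e) (inj₂ x) = entry-bound e x

    level-step : ∀ c σ → level (step c σ) σ ≡ B ⊓ suc (level c σ)
    level-step (s , e) (inj₁ x) = entry-move s x
    level-step (s , e) (inj₂ x) = entry-move e x

    level-step-≢ : ∀ c {σ τ} → σ ≢ τ → level (step c σ) τ ≡ level c τ
    level-step-≢ (s , e) {inj₁ x} {inj₁ y} ne = entry-move-≢ s (ne ∘ cong inj₁)
    level-step-≢ (s , e) {inj₂ x} {inj₂ y} ne = entry-move-≢ e (ne ∘ cong inj₂)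
    level-step-≢ (s , e) {inj₁ x} {inj₂ y} ne = refl
    level-step-≢ (s , e) {inj₂ x} {inj₁ y} ne = refl

    level-injective : ∀ {c c′} → (∀ σ → level c σ ≡ level c′ σ) → c ≡ c′
    level-injective h = cong₂ _,_ (entry-injective (h ∘ inj₁)) (entry-injective (h ∘ inj₂))

    total : Config → ℕ
    total (s , e) = altitude s + altitude e

    total-bound : ∀ c → total c ≤ sizeS P * (sizeS A * B) + sizeE P * (sizeE A * B)
    total-bound (s , e) = +-mono-≤ (altitude-bound s) (altitude-bound e)

    step-grows : ∀ c σ → step c σ ≡ c ⊎ total c < total (step c σ)
    step-grows (s , e) (inj₁ x) = Sum.map (cong (_, e)) (+-monoˡ-< _) (move-grows s x)
    step-grows (s , e) (inj₂ x) = Sum.map (cong (s ,_)) (+-monoʳ-< _) (move-grows e x)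

    config : List Letter → Config
    config = foldl step (start , start)

    config-∷ʳ : ∀ u σ → config (u ∷ʳ σ) ≡ step (config u) σ
    config-∷ʳ u σ = List.foldl-∷ʳ step (start , start) σ u

    occurrences : Letter → List Letter → ℕ
    occurrences σ []      = 0
    occurrences σ (τ ∷ u) = (if does (τ ≟L σ) then 1 else 0) + occurrences σ u

    level-foldl : ∀ σ c u → level (foldl step c u) σ ≡ B ⊓ (level c σ + occurrences σ u)
    level-foldl σ c [] = sym (trans (cong (B ⊓_) (+-identityʳ _)) (m≥n⇒m⊓n≡n (level-bound c σ)))
    level-foldl σ c (τ ∷ u) with level-foldl σ (step c τ) u | τ ≟L σ
    ... | ih | no ne rewrite level-step-≢ c ne = ih
    ... | ih | yes refl rewrite level-step c σ = trans ih
      (trans (⊓-absorb B (suc (level c σ)) (occurrences σ u)) (cong (B ⊓_) (sym (+-suc _ _))))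

    level-config : ∀ σ u → level (config u) σ ≡ B ⊓ occurrences σ u
    level-config σ@(inj₁ x) u rewrite level-foldl σ (start , start) u | entry-start x = refl
    level-config σ@(inj₂ x) u rewrite level-foldl σ (start , start) u | entry-start x = refl

    card-finite : ∀ k σ u → Card k (λ i → lookup u i ≡ σ) (occurrences σ u)
    card-finite k σ [] = card-empty k λ ()
    card-finite zero σ (τ ∷ u) = tt
    card-finite (suc k) σ (τ ∷ u) with τ ≟L σ
    ... | yes e = card-insert Fin._≟_ k e
      (card-inj k suc Fin.suc-injective (λ { zero (_ , ne) → ⊥-elim (ne refl) ; (suc i) _ → i , refl })
        (card-ext k (λ i e → e , λ ()) (λ i → proj₁) (card-finite k σ u)))
    ... | no ne = card-inj (suc k) suc Fin.suc-injective (λ { zero e → ⊥-elim (ne e) ; (suc i) _ → i , refl })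
        (card-finite (suc k) σ u)

    card-prefix : ∀ k σ n (w : ℕ → Letter) → Card k (λ i → i < n × w i ≡ σ) (occurrences σ (applyUpTo w n))
    card-prefix k σ zero w = card-empty k λ _ ()
    card-prefix zero σ (suc n) w = tt
    card-prefix (suc k) σ (suc n) w with w 0 ≟L σ
    ... | yes e = card-insert _≟_ k (s≤s z≤n , e)
      (card-inj k suc suc-injective (λ { zero (_ , ne) → ⊥-elim (ne refl) ; (suc i) _ → i , refl })
        (card-ext k (λ i (l , e) → (s≤s l , e) , λ ()) (λ { i ((s≤s l , e) , _) → l , e }) (card-prefix k σ n (w ∘ suc))))
    ... | no ne = card-inj (suc k) suc suc-injective (λ { zero (_ , e) → ⊥-elim (ne e) ; (suc i) _ → i , refl })
        (card-ext (suc k) (λ i (l , e) → s≤s l , e) (λ { i (s≤s l , e) → l , e }) (card-prefix (suc k) σ n (w ∘ suc)))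

    Realizes : DataWord → Config → Set
    Realizes w c = ∀ σ → Card B (λ i → letterAt w i ≡ σ) (level c σ)

    realizes-finite : ∀ u → Realizes (finite u) (config u)
    realizes-finite u σ rewrite level-config σ u = card-⊓ B (card-finite B σ u)

    Stabilises : (ℕ → Letter) → ℕ → Set
    Stabilises w n = ∀ i → n ≤ i → config (applyUpTo w i) ≡ config (applyUpTo w n)

    config-next : ∀ w i → config (applyUpTo w (suc i)) ≡ step (config (applyUpTo w i)) (w i)
    config-next w i = trans (cong config (sym (List.applyUpTo-∷ʳ w i))) (config-∷ʳ (applyUpTo w i) (w i))

    -- A letter played after stabilisation leaves the configuration as it is, whereas a level below
    -- `B` would have risen by one.
    stable-saturated : ∀ {w n} → Stabilises w n → ∀ i → n ≤ i → B ≤ level (config (applyUpTo w n)) (w i)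
    stable-saturated {w} {n} st i l = ≮⇒≥ λ lt → 1+n≢n (trans
      (sym (trans (level-step c (w i)) (m≥n⇒m⊓n≡n lt)))
      (cong (λ c → level c (w i)) (trans (cong (λ c → step c (w i)) (sym (st i l)))
        (trans (sym (config-next w i)) (st (suc i) (m≤n⇒m≤1+n l))))))
      where c = config (applyUpTo w n)

    -- A letter with `B` occurrences in the stable prefix is capped for good. Any other letter is
    -- not saturated, hence never played again, and the prefix holds all its occurrences.
    realizes-infinite : ∀ w n → Stabilises w n → Realizes (infinite w) (config (applyUpTo w n))
    realizes-infinite w n st σ with B ≤? occurrences σ (applyUpTo w n)
    ... | yes l rewrite level-config σ (applyUpTo w n) | m≤n⇒m⊓n≡m l =
      card-cap B l ≤-refl (card-⊇ B (λ i → i <? n ×-dec w i ≟L σ) _≟_ (λ i → proj₂) l (card-prefix B σ n w))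
    ... | no ¬l = subst (Card B _) (sym lev) (card-ext B (λ i → proj₂) (λ i e → early i e , e) (card-prefix B σ n w))
      where
      lev : level (config (applyUpTo w n)) σ ≡ occurrences σ (applyUpTo w n)
      lev = trans (level-config σ (applyUpTo w n)) (m≥n⇒m⊓n≡n (<⇒≤ (≰⇒> ¬l)))
      early : ∀ i → w i ≡ σ → i < n
      early i refl = ≰⇒> λ l → ¬l (≤-trans (stable-saturated st i l) (≤-reflexive lev))

    -- An enumeration in `Finite` may list a letter twice, so only the copies still missing are
    -- added.
    fill : (Letter → ℕ) → List Letter → List Letter
    fill f []       = []
    fill f (σ ∷ xs) = replicate (f σ ∸ occurrences σ (fill f xs)) σ ++ fill f xs

    occurrences-replicate : ∀ k σ u → occurrences σ (replicate k σ ++ u) ≡ k + occurrences σ u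
    occurrences-replicate zero    σ u = refl
    occurrences-replicate (suc k) σ u with σ ≟L σ
    ... | yes _ = cong suc (occurrences-replicate k σ u)
    ... | no ne = ⊥-elim (ne refl)

    occurrences-replicate-≢ : ∀ k {σ τ} → τ ≢ σ → ∀ u → occurrences σ (replicate k τ ++ u) ≡ occurrences σ u
    occurrences-replicate-≢ zero    ne u = refl
    occurrences-replicate-≢ (suc k) {σ} {τ} ne u with τ ≟L σ
    ... | yes e = ⊥-elim (ne e)
    ... | no _  = occurrences-replicate-≢ k ne u

    fill-≤ : ∀ f σ xs → occurrences σ (fill f xs) ≤ f σ
    fill-≤ f σ [] = z≤n
    fill-≤ f σ (τ ∷ xs) with τ ≟L σ
    ... | yes refl rewrite occurrences-replicate (f σ ∸ occurrences σ (fill f xs)) σ (fill f xs) =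
      ≤-reflexive (m∸n+n≡m (fill-≤ f σ xs))
    ... | no ne rewrite occurrences-replicate-≢ (f τ ∸ occurrences τ (fill f xs)) ne (fill f xs) = fill-≤ f σ xs

    fill-∈ : ∀ f σ xs → σ ∈ xs → occurrences σ (fill f xs) ≡ f σ
    fill-∈ f σ (τ ∷ xs) m with τ ≟L σ
    ... | yes refl rewrite occurrences-replicate (f σ ∸ occurrences σ (fill f xs)) σ (fill f xs) =
      m∸n+n≡m (fill-≤ f σ xs)
    fill-∈ f σ (τ ∷ xs) (here e)  | no ne = ⊥-elim (ne (sym e))
    fill-∈ f σ (τ ∷ xs) (there m) | no ne
      rewrite occurrences-replicate-≢ (f τ ∸ occurrences τ (fill f xs)) ne (fill f xs) = fill-∈ f σ xs m

    finite-Letter : Finite Letter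
    finite-Letter = finite-⊎ (finite-× (finite-Fin _) (finite-Fin _)) (finite-× (finite-Fin _) (finite-Fin _))

    wordOf : Config → List Letter
    wordOf c = fill (level c) (Finite.elements finite-Letter)

    config-wordOf : ∀ c → config (wordOf c) ≡ c
    config-wordOf c = level-injective λ σ → trans (level-config σ (wordOf c))
      (trans (cong (B ⊓_) (fill-∈ (level c) σ _ (Finite.complete finite-Letter σ))) (m≥n⇒m⊓n≡n (level-bound c σ)))

    realizes-wordOf : ∀ c → Realizes (finite (wordOf c)) c
    realizes-wordOf c = subst (Realizes (finite (wordOf c))) (config-wordOf c) (realizes-finite (wordOf c))

    open Transfer A B using (Profile)

    profile : ∀ w c → Realizes w c → Profile P
    profile w (s , e) r = record
      { word = w ; system = Vec.lookup s ; environment = Vec.lookup e ; profile-counts = pc }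
      where
      pc : ∀ p a → Card B (λ i → action (letterAt w i) ≡ a × process (letterAt w i) ≡ p)
                     (Transfer.cnt A B (Sum.map (Vec.lookup s) (Vec.lookup e) p) a)
      pc (inj₁ p) (inj₁ a) = card-ext B (λ i e → cong action e , cong process e)
        (λ i (e , e′) → join (letterAt w i) e e′) (r (inj₁ (a , p)))
        where join : ∀ σ → action σ ≡ inj₁ a → process σ ≡ inj₁ p → σ ≡ inj₁ (a , p)
              join (inj₁ _) refl refl = refl
      pc (inj₂ p) (inj₂ a) = card-ext B (λ i e → cong action e , cong process e)
        (λ i (e , e′) → join (letterAt w i) e e′) (r (inj₂ (a , p)))
        where join : ∀ σ → action σ ≡ inj₂ a → process σ ≡ inj₂ p → σ ≡ inj₂ (a , p)
              join (inj₂ _) refl refl = refl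
      pc (inj₁ p) (inj₂ a) = card-empty B λ i (e , e′) → clash (letterAt w i) e e′
        where clash : ∀ σ → action σ ≡ inj₂ a → process σ ≡ inj₁ p → ⊥
              clash (inj₁ _) () e
              clash (inj₂ _) e ()
      pc (inj₂ p) (inj₁ a) = card-empty B λ i (e , e′) → clash (letterAt w i) e e′
        where clash : ∀ σ → action σ ≡ inj₁ a → process σ ≡ inj₂ p → ⊥
              clash (inj₁ _) e ()
              clash (inj₂ _) () e

    -- Fixing one finite word per configuration makes acceptance decidable. For sentences of rank at
    -- most `B` the choice is immaterial by `realizes-transfer`, even against infinite words.
    Accepting : Sentence A → Config → Set
    Accepting φ c = finite (wordOf c) ⊨ φ

    accepting? : ∀ φ → Decidable (Accepting φ)
    accepting? φ c = ⊨? (wordOf c) φ _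

  module _ {A P P′ : FiniteSplit} where
    private
      module G = Words A P
      module G′ = Words A P′

    ~-types : ∀ {s s′ e e′} → _~_ {n = sizeS P} {sizeS P′} s s′ → _~_ {n = sizeE P} {sizeE P′} e e′ →
              ∀ (τ : Transfer.Type A B) →
              ∃[ t ] Card B (λ p → Sum.map (Vec.lookup s) (Vec.lookup e) p ≡ τ) t
                   × Card B (λ p → Sum.map (Vec.lookup s′) (Vec.lookup e′) p ≡ τ) t
    ~-types h h′ (inj₁ v) with t , c , c′ ← h v = t , lift c , lift c′
      where
      lift : ∀ {X X′ : Set} {f : X → _} {g : X′ → _} {t} → Card B (λ p → f p ≡ v) t →
             Card B (λ p → Sum.map f g p ≡ inj₁ v) t
      lift c = card-inj B inj₁ Sum.inj₁-injective (λ { (inj₁ p) _ → p , refl ; (inj₂ p) () })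
        (card-ext B (λ _ → cong inj₁) (λ _ → Sum.inj₁-injective) c)
    ~-types h h′ (inj₂ v) with t , c , c′ ← h′ v = t , lift c , lift c′
      where
      lift : ∀ {X X′ : Set} {f : X → _} {g : X′ → _} {t} → Card B (λ p → g p ≡ v) t →
             Card B (λ p → Sum.map f g p ≡ inj₂ v) t
      lift c = card-inj B inj₂ Sum.inj₂-injective (λ { (inj₂ p) _ → p , refl ; (inj₁ p) () })
        (card-ext B (λ _ → cong inj₂) (λ _ → Sum.inj₂-injective) c)

    realizes-transfer : ∀ (φ : Sentence A) → rank φ ≤ B → ∀ {w w′ s s′ e e′} →
      G.Realizes w (s , e) → G′.Realizes w′ (s′ , e′) → s ~ s′ → e ~ e′ → Game._⊨_ A P w φ → Game._⊨_ A P′ w′ φ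
    realizes-transfer φ l {s = s} {s′} {e} {e′} r r′ h h′ =
      Transfer.transfer-sentence A B (G.profile _ (s , e) r) (G′.profile _ (s′ , e′) r′) φ l (~-types {s} {s′} {e} {e′} h h′)

-- Strategies and the finite game

snoc-split : ∀ {X : Set} (u : List X) {σ} v {τ y} → u ∷ʳ σ ≡ v ++ τ ∷ y →
             (u ≡ v × σ ≡ τ) ⊎ ∃[ y′ ] u ≡ v ++ τ ∷ y′
snoc-split []      []      refl = inj₁ (refl , refl)
snoc-split (x ∷ u) []      refl = inj₂ (u , refl)
snoc-split []      (z ∷ []) ()
snoc-split []      (z ∷ z′ ∷ v) ()
snoc-split (x ∷ u) (z ∷ v) eq with refl , eq′ ← List.∷-injective eq =
  Sum.map (λ (e , e′) → cong (x ∷_) e , e′) (λ (y , e) → y , cong (x ∷_) e) (snoc-split u v eq′)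

applyUpTo-split : ∀ {X : Set} (w : ℕ → X) i j →
                  applyUpTo w (i + suc j) ≡ applyUpTo w i ++ w i ∷ applyUpTo (λ k → w (i + suc k)) j
applyUpTo-split w zero    j = refl
applyUpTo-split w (suc i) j = cong (w 0 ∷_) (applyUpTo-split (w ∘ suc) i j)

prepend : ∀ {X : Set} → List X → (ℕ → X) → ℕ → X
prepend []      v i       = v i
prepend (x ∷ u) v zero    = x
prepend (x ∷ u) v (suc i) = prepend u v i

prepend-+ : ∀ {X : Set} (u : List X) v k → prepend u v (length u + k) ≡ v k
prepend-+ []      v k = refl
prepend-+ (x ∷ u) v k = prepend-+ u v k

applyUpTo-prepend : ∀ {X : Set} (u : List X) v k → applyUpTo (prepend u v) (length u + k) ≡ u ++ applyUpTo v k
applyUpTo-prepend []      v k = refl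
applyUpTo-prepend (x ∷ u) v k = cong (x ∷_) (applyUpTo-prepend u v k)

split-at : ∀ {X : Set} (u : List X) i → u ≡ take (toℕ i) u ++ lookup u i ∷ drop (suc (toℕ i)) u
split-at (x ∷ u) zero    = refl
split-at (x ∷ u) (suc i) = cong (x ∷_) (split-at u i)

middle : ∀ {X : Set} (v : List X) x y → ∃[ i ] lookup (v ++ x ∷ y) i ≡ x × take (toℕ i) (v ++ x ∷ y) ≡ v
middle []      x y = zero , refl , refl
middle (z ∷ v) x y with i , e , e′ ← middle v x y = suc i , e , cong (z ∷_) e′

module Synthesis (A : FiniteSplit) (φ : Sentence A) where

  B : ℕ
  B = rank φ

  open Configuration B

  SystemTeam EnvironmentTeam : ℕ → Set
  SystemTeam      = Team (sizeS A)
  EnvironmentTeam = Team (sizeE A)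

  Accepted : SystemTeam n → EnvironmentTeam m → Set
  Accepted {n} {m} s e = Words.Accepting A (split n m) φ (s , e)

  accepted? : (s : SystemTeam n) (e : EnvironmentTeam m) → Dec (Accepted s e)
  accepted? s e = Words.accepting? A _ φ (s , e)

  accepted-~ : {s : SystemTeam n} {s′ : SystemTeam n′} {e : EnvironmentTeam m} {e′ : EnvironmentTeam m′} →
               s ~ s′ → e ~ e′ → Accepted s e → Accepted s′ e′
  accepted-~ {s = s} {s′} {e} {e′} h h′ =
    realizes-transfer φ ≤-refl (Words.realizes-wordOf A _ (s , e)) (Words.realizes-wordOf A _ (s′ , e′)) h h′

  -- Moves of different players commute, so when Environment interrupts System on
  -- its way to s′, System can go to s′ first and only then take the move into account.
  Wins  : ℕ → SystemTeam n → EnvironmentTeam m → Set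
  After : ℕ → SystemTeam n → EnvironmentTeam m → Set
  Wins r s e = ∃[ s′ ] s ⊑ s′ × Accepted s′ e × After r s′ e
  After zero    s e = ⊤
  After (suc r) s e = ∀ x → Wins r s (move e x)

  wins? : ∀ r (s : SystemTeam n) (e : EnvironmentTeam m) → Dec (Wins r s e)
  after? : ∀ r (s : SystemTeam n) (e : EnvironmentTeam m) → Dec (After r s e)
  wins? r s e = Finite.any (finite-Team _ _) λ s′ → s ⊑? s′ ×-dec accepted? s′ e ×-dec after? r s′ e
  after? zero    s e = yes tt
  after? (suc r) s e = Finite.all (finite-× (finite-Fin _) (finite-Fin _)) λ x → wins? r s (move e x)

  -- Here Environment makes several moves at once; the double negation stands for
  -- the missing decidability of the quantification over lists of moves.
  WinsC  : ℕ → SystemTeam n → EnvironmentTeam m → Set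
  AfterC : ℕ → SystemTeam n → EnvironmentTeam m → Set
  WinsC r s e = ¬ ¬ (∃[ s′ ] s ⊑ s′ × Accepted s′ e × AfterC r s′ e)
  AfterC zero    s e = ⊤
  AfterC (suc r) s e = ∀ xs → WinsC r s (foldl move e xs)

  winsC⇒wins : ∀ r {s : SystemTeam n} {e : EnvironmentTeam m} → WinsC r s e → Wins r s e
  afterC⇒after : ∀ r {s : SystemTeam n} {e : EnvironmentTeam m} → AfterC r s e → After r s e
  winsC⇒wins r {s} {e} h = decidable-stable (wins? r s e)
    λ κ → h λ (s′ , l , acc , next) → κ (s′ , l , acc , afterC⇒after r next)
  afterC⇒after zero    h   = tt
  afterC⇒after (suc r) {s} h x = winsC⇒wins r {s} (h (x ∷ []))

  wins-antitone : ∀ r {s s′ : SystemTeam n} {e : EnvironmentTeam m} → s ⊑ s′ → Wins r s′ e → Wins r s e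
  wins-antitone r {s} {s′} l (s″ , l′ , h) =
    s″ , ⊑-trans {c = s} {s′} {s″} l l′ , h

  start-⊑ : (s : SystemTeam n) → start ⊑ s
  start-⊑ s x rewrite entry-start x = z≤n

  -- The largest altitude of a team of `m` Environment processes, hence a bound on the number of its
  -- effective moves.
  gameHeight : ℕ → ℕ
  gameHeight m = m * (sizeE A * B)

  module Play (P : FiniteSplit) where
    open Game A P
    open Words A P
    open Semantics {A} {P}

    sys : List Letter → SystemTeam (sizeS P)
    sys u = proj₁ (config u)

    env : List Letter → EnvironmentTeam (sizeE P)
    env u = proj₂ (config u)

    -- The first clause of compatibility for finite words, phrased by factorisations instead of
    -- positions, which suits prefixes and appended letters.
    Consistent : Strategy → List Letter → Set
    Consistent 𝒮 u = ∀ v x y → u ≡ v ++ inj₁ x ∷ y → 𝒮 v ≡ just x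

    consistent-[] : ∀ {𝒮} → Consistent 𝒮 []
    consistent-[] []      x y ()
    consistent-[] (_ ∷ _) x y ()

    consistent-∷ʳ : ∀ {𝒮 u σ} → Consistent 𝒮 u → (∀ x → σ ≡ inj₁ x → 𝒮 u ≡ just x) → Consistent 𝒮 (u ∷ʳ σ)
    consistent-∷ʳ {u = u} c h v x y eq with snoc-split u v eq
    ... | inj₁ (refl , e) = h x e
    ... | inj₂ (y′ , e)   = c v x y′ e

    consistent-init : ∀ {𝒮 u σ} → Consistent 𝒮 (u ∷ʳ σ) → Consistent 𝒮 u
    consistent-init {σ = σ} c v x y refl = c v x (y ∷ʳ σ) (List.++-assoc v (inj₁ x ∷ y) (σ ∷ []))

    stabilisation : ∀ w → ¬ ¬ ∃ (Stabilises w)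
    stabilisation w = from (bound ∸ total (c 0)) 0 (≤-reflexive (sym (m∸n+n≡m (total-bound (c 0)))))
      where
      bound = sizeS P * (sizeS A * B) + sizeE P * (sizeE A * B)
      c : ℕ → Config
      c i = config (applyUpTo w i)
      -- `d` bounds how often the total can still rise. Either it rises at some later time, or it
      -- has its final value and all further steps are idle.
      from : ∀ d i → bound ≤ d + total (c i) → ¬ ¬ ∃ (Stabilises w)
      from d i l κ = ¬¬-excluded-middle {A = ∃[ j ] i ≤ j × total (c i) < total (c j)} λ
        { (yes (j , _ , lt)) → higher d j lt l
        ; (no max) → κ (i , λ j le → constant max (≤⇒≤′ le)) }
        where
        higher : ∀ d j → total (c i) < total (c j) → bound ≤ d + total (c i) → ⊥
        higher zero    j lt l = <⇒≱ lt (≤-trans (total-bound (c j)) l)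
        higher (suc d) j lt l = from d j (≤-trans l (≤-trans (≤-reflexive (sym (+-suc d _))) (+-monoʳ-≤ d lt))) κ
        constant : ¬ (∃[ j ] i ≤ j × total (c i) < total (c j)) → ∀ {j} → i ≤′ j → c j ≡ c i
        constant max (≤′-reflexive refl) = refl
        constant max (≤′-step {j} le) with step-grows (c j) (w j)
        ... | inj₁ e  = trans (config-next w j) (trans e (constant max le))
        ... | inj₂ lt = ⊥-elim (max (suc j , m≤n⇒m≤1+n (≤′⇒≤ le) ,
          subst₂ (λ a b → total a < total b) (constant max le) (sym (config-next w j)) lt))

    satisfies⇒accepted : ∀ {w c} → Realizes w c → w ⊨ φ → Accepting φ c
    satisfies⇒accepted {c = s , e} r = realizes-transfer φ ≤-refl r (realizes-wordOf (s , e)) (~-refl s) (~-refl e)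

    accepted⇒satisfies : ∀ {w c} → Realizes w c → Accepting φ c → w ⊨ φ
    accepted⇒satisfies {c = s , e} r = realizes-transfer φ ≤-refl (realizes-wordOf (s , e)) r (~-refl s) (~-refl e)

    -- From winning strategies to the finite game

    module FromStrategy (𝒮 : Strategy) (winning : Winning φ 𝒮) where

      record Continuation (u u′ : List Letter) : Set where
        field
          consistent : Consistent 𝒮 u′
          sys-⊒      : sys u ⊑ sys u′
          env-≡      : env u′ ≡ env u

      open Continuation


      module _ (u : List Letter) (c : Consistent 𝒮 u) where

        -- Environment stays silent while System follows its strategy; after ε the run no longer
        -- changes.
        run : ℕ → List Letter
        run zero    = u
        run (suc k) = maybe (λ x → run k ∷ʳ inj₁ x) (run k) (𝒮 (run k))

        run-continues : ∀ k → Continuation u (run k)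
        run-continues zero = record { consistent = c ; sys-⊒ = ⊑-refl {c = sys u} ; env-≡ = refl }
        run-continues (suc k) with 𝒮 (run k) in eq
        ... | nothing = run-continues k
        ... | just x  = record
          { consistent = consistent-∷ʳ (consistent (run-continues k)) λ { y refl → eq }
          ; sys-⊒ = ⊑-trans {c = sys u} {sys (run k)} {sys (run k ∷ʳ inj₁ x)} (sys-⊒ (run-continues k))
              (subst (λ d → sys (run k) ⊑ proj₁ d) (sym (config-∷ʳ (run k) (inj₁ x))) (move-⊒ (sys (run k)) x))
          ; env-≡ = trans (cong proj₂ (config-∷ʳ (run k) (inj₁ x))) (env-≡ (run-continues k)) }

        stopping : ∀ k → 𝒮 (run k) ≡ nothing → Accepting φ (config (run k))
        stopping k eq = satisfies⇒accepted (realizes-finite (run k)) (winning (finite (run k))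
          ((λ i s e → consistent (run-continues k) _ s _ (trans (split-at (run k) i)
              (cong (λ σ → take (toℕ i) (run k) ++ σ ∷ drop (suc (toℕ i)) (run k)) e)))
            , λ { _ refl → eq })
          -- Fairness is vacuous on a finite word: no index reaches its length.
          (λ often → ⊥-elim (often (length (run k)) λ (i , l , _) → <⇒≱ (Fin.toℕ<n i) l)))

        module _ (never : ∀ k → 𝒮 (run k) ≢ nothing) where

          next : ∀ k → ∃[ x ] 𝒮 (run k) ≡ just x
          next k with 𝒮 (run k) in eq
          ... | just x  = x , refl
          ... | nothing = ⊥-elim (never k eq)

          moves : ℕ → Letter
          moves k = inj₁ (proj₁ (next k))

          w : ℕ → Letter
          w = prepend u moves

          run-prefix : ∀ k → run k ≡ u ++ applyUpTo moves k
          run-prefix zero = sym (List.++-identityʳ u)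
          run-prefix (suc k) = begin
            run (suc k)                          ≡⟨ cong (maybe (λ x → run k ∷ʳ inj₁ x) (run k)) (proj₂ (next k)) ⟩
            run k ∷ʳ moves k                      ≡⟨ cong (_∷ʳ moves k) (run-prefix k) ⟩
            (u ++ applyUpTo moves k) ∷ʳ moves k    ≡⟨ List.++-assoc u _ _ ⟩
            u ++ (applyUpTo moves k ∷ʳ moves k)    ≡⟨ cong (u ++_) (List.applyUpTo-∷ʳ moves k) ⟩
            u ++ applyUpTo moves (suc k)          ∎
            where open ≡-Reasoning

          prefix-run : ∀ k → applyUpTo w (length u + k) ≡ run k
          prefix-run k = trans (applyUpTo-prepend u moves k) (sym (run-prefix k))

          compatible : Compatible 𝒮 (infinite w)
          -- Position `i` lies inside `run (suc i)`, which is known to be consistent.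
          compatible = (λ i s e → consistent (run-continues (suc i)) _ s _ (begin
              run (suc i)                       ≡⟨ prefix-run (suc i) ⟨
              applyUpTo w (length u + suc i)    ≡⟨ cong (applyUpTo w) shift ⟩
              applyUpTo w (i + suc (length u))  ≡⟨ applyUpTo-split w i (length u) ⟩
              applyUpTo w i ++ w i ∷ rest i     ≡⟨ cong (λ σ → applyUpTo w i ++ σ ∷ rest i) e ⟩
              applyUpTo w i ++ inj₁ s ∷ rest i  ∎)) , λ _ ()
            where
            open ≡-Reasoning
            shift : ∀ {i} → length u + suc i ≡ i + suc (length u)
            shift {i} = trans (+-suc _ i) (trans (cong suc (+-comm _ i)) (sym (+-suc i _)))
            rest : ℕ → List Letter
            rest i = applyUpTo (λ k → w (i + suc k)) (length u)

          -- From `length u` on, every position is a System move.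
          fair : Fair 𝒮 (infinite w)
          fair _ k κ = κ (length u + k , m≤n+m k (length u) , proj₁ (next k) , prepend-+ u moves k)

          running : ¬ ¬ (∃[ k ] Accepting φ (config (run k)))
          -- The point of stabilisation is delayed by `length u`, so that the stable prefix is one
          -- of the runs.
          running κ = stabilisation w λ (k , st) → κ (k , subst (Accepting φ ∘ config) (prefix-run k)
            (satisfies⇒accepted (realizes-infinite w (length u + k) (later k st)) (winning (infinite w) compatible fair)))
            where
            later : ∀ k → Stabilises w k → Stabilises w (length u + k)
            later k st i l = trans (st i (≤-trans (m≤n+m k (length u)) l)) (sym (st (length u + k) (m≤n+m k (length u))))

        -- Environment may fall silent for good after `u`. Whether System then stops or plays
        -- forever, the play is compatible and fair, hence satisfies φ, and its final configuration
        -- is reached after finitely many moves.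
        eventually : ¬ ¬ (∃[ u′ ] Continuation u u′ × Accepting φ (config u′))
        eventually κ = ¬¬-excluded-middle {A = ∃[ k ] 𝒮 (run k) ≡ nothing} λ
          { (yes (k , e)) → κ (run k , run-continues k , stopping k e)
          ; (no never) → running (λ k e → never (k , e)) λ (k , acc) → κ (run k , run-continues k , acc) }

      challenge : List Letter → List LetterE → List Letter
      challenge = foldl (λ u x → u ∷ʳ inj₂ x)

      consistent-challenge : ∀ u xs → Consistent 𝒮 u → Consistent 𝒮 (challenge u xs)
      consistent-challenge u []       c = c
      consistent-challenge u (x ∷ xs) c = consistent-challenge _ xs (consistent-∷ʳ c λ _ ())

      config-challenge : ∀ u xs → config (challenge u xs) ≡ (sys u , foldl move (env u) xs)
      config-challenge u []       = refl
      config-challenge u (x ∷ xs) = trans (config-challenge (u ∷ʳ inj₂ x) xs)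
        (cong (λ (s , e) → s , foldl move e xs) (config-∷ʳ u (inj₂ x)))

      -- A round is a silence of Environment, long enough to reach acceptance, followed by a burst
      -- `xs`. The burst is always legal, since consistency constrains System letters only.
      winsC : ∀ r u → Consistent 𝒮 u → WinsC r (sys u) (env u)
      winsC r u c κ = eventually u c λ (u′ , cont , acc) →
        κ (sys u′ , sys-⊒ cont , subst (Accepted (sys u′)) (env-≡ cont) acc ,
           subst (AfterC r (sys u′)) (env-≡ cont) (after r u′ (consistent cont)))
        where
        after : ∀ r u → Consistent 𝒮 u → AfterC r (sys u) (env u)
        after zero    u c    = tt
        after (suc r) u c xs = subst (λ (s , e) → WinsC r s e) (config-challenge u xs)
          (winsC r (challenge u xs) (consistent-challenge u xs c))

    winning⇒winsC : ∀ {𝒮} → Winning φ 𝒮 → ∀ r → WinsC {sizeS P} {sizeE P} r start start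
    winning⇒winsC {𝒮} win r = FromStrategy.winsC 𝒮 win r [] (consistent-[] {𝒮})

    -- From the finite game to winning strategies

    record Node : Set where
      constructor node
      field
        fuel   : ℕ
        base   : SystemTeam (sizeS P)
        current   : EnvironmentTeam (sizeE P)
        wins   : Wins fuel base current
        -- The rounds left cover every rise that Environment can still make, so an effective move
        -- never meets a node without fuel.
        enough : gameHeight (sizeE P) ≤ fuel + altitude current

      target : SystemTeam (sizeS P)
      target = proj₁ wins

    open Node

    -- A move on a saturated counter changes nothing, so the node is kept and no round is spent. An
    -- effective move spends one round, and the new target lies above the old one, which was the
    -- base of the next position.
    descend : ∀ N x → ∃[ N′ ] current N′ ≡ move (current N) x × target N ⊑ target N′
    descend N@(node r s e h l) x with move-grows e x
    ... | inj₁ eq = N , sym eq , ⊑-refl {c = target N}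
    descend (node zero s e h l) x | inj₂ lt = ⊥-elim (<⇒≱ lt (≤-trans (altitude-bound (move e x)) l))
    descend (node (suc r) s e (s′ , s⊑s′ , acc , h) l) x | inj₂ lt =
      node r s′ (move e x) (h x) (≤-trans l (≤-trans (≤-reflexive (sym (+-suc r _))) (+-monoʳ-≤ r lt))) ,
      refl , proj₁ (proj₂ (h x))

    advance : Node → Letter → Node
    advance N (inj₁ _) = N
    advance N (inj₂ x) = proj₁ (descend N x)

    module ToStrategy (N₀ : Node) (env-N₀ : current N₀ ≡ start) where

      nodeAt : List Letter → Node
      nodeAt = foldl advance N₀

      nodeAt-∷ʳ : ∀ u σ → nodeAt (u ∷ʳ σ) ≡ advance (nodeAt u) σ
      nodeAt-∷ʳ u σ = List.foldl-∷ʳ advance N₀ σ u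

      env-foldl : ∀ u N c → current N ≡ proj₂ c → current (foldl advance N u) ≡ proj₂ (foldl step c u)
      env-foldl []           N c e = e
      env-foldl (inj₁ x ∷ u) N c e = env-foldl u N _ e
      env-foldl (inj₂ x ∷ u) N c e = env-foldl u _ _ 
        (trans (proj₁ (proj₂ (descend N x))) (cong (λ e → move e x) e))

      env-nodeAt : ∀ u → current (nodeAt u) ≡ env u
      env-nodeAt u = env-foldl u N₀ _ env-N₀

      goal : List Letter → SystemTeam (sizeS P)
      goal u = target (nodeAt u)

      missing? : ∀ u → Dec (∃[ x ] entry (sys u) x < entry (goal u) x)
      missing? u = Finite.any (finite-× (finite-Fin _) (finite-Fin _)) λ x → entry (sys u) x <? entry (goal u) x

      strategy : Strategy
      strategy u with missing? u
      ... | yes (x , _) = just x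
      ... | no _        = nothing

      strategy-just : ∀ {u x} → strategy u ≡ just x → entry (sys u) x < entry (goal u) x
      strategy-just {u} eq with missing? u | eq
      ... | yes (x , l) | refl = l

      strategy-nothing : ∀ {u} → strategy u ≡ nothing → goal u ⊑ sys u
      strategy-nothing {u} eq x with missing? u
      ... | no none = ≮⇒≥ λ l → none (x , l)

      -- System plays only letters still missing from the target, and Environment's moves only raise
      -- the target. So when the strategy stops, System stands exactly on an accepted target.
      below-goal : ∀ u → Consistent strategy u → sys u ⊑ goal u
      below-goal u = view (reverseView u)
        where
        view : ∀ {u} → Reverse u → Consistent strategy u → sys u ⊑ goal u
        view [] c = start-⊑ (goal [])
        view (u ∶ r ∶ʳ inj₁ x) c
          rewrite config-∷ʳ u (inj₁ x) | nodeAt-∷ʳ u (inj₁ x) =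
          move-⊑ {c = sys u} {goal u} (view r (consistent-init {strategy} {u} c)) (strategy-just (c u x [] refl))
        view (u ∶ r ∶ʳ inj₂ x) c
          rewrite config-∷ʳ u (inj₂ x) | nodeAt-∷ʳ u (inj₂ x) =
          ⊑-trans {c = sys u} {goal u} {target (proj₁ (descend (nodeAt u) x))}
            (view r (consistent-init {strategy} {u} c)) (proj₂ (proj₂ (descend (nodeAt u) x)))

      accepted-goal : ∀ u → Consistent strategy u → strategy u ≡ nothing → Accepting φ (config u)
      accepted-goal u c eq = subst₂ Accepted
        (entry-injective λ x → ≤-antisym (strategy-nothing {u} eq x) (below-goal u c x)) (env-nodeAt u)
        (proj₁ (proj₂ (proj₂ (wins (nodeAt u)))))

      winning : Winning φ strategy
      winning (finite u) (compat , stops) _ =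
        accepted⇒satisfies (realizes-finite u) (accepted-goal u consistent (stops u refl))
        where
        consistent : Consistent strategy u
        consistent v x y refl with i , e , e′ ← middle v (inj₁ x) y =
          trans (cong strategy (sym e′)) (compat i x e)
      -- If the strategy rests at some time after stabilisation, the configuration at that time is
      -- both accepted and final.
      winning (infinite w) (compat , _) fair = ⊨-stable (infinite w) φ _ λ κ →
        stabilisation w λ (k , st) → rests k st λ (i , k≤i , eq) →
          κ (accepted⇒satisfies (realizes-infinite w k st)
              (subst (Accepting φ) (st i k≤i) (accepted-goal (applyUpTo w i) (consistent i) eq)))
        where
        consistent : ∀ i → Consistent strategy (applyUpTo w i)
        consistent zero    = consistent-[] {strategy}
        consistent (suc i) = subst (Consistent strategy) (List.applyUpTo-∷ʳ w i)
          (consistent-∷ʳ (consistent i) (compat i))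
        -- Otherwise the strategy would demand a move at all times from `k` on, and fairness would
        -- produce a System letter there. This letter is saturated at `B` by stability, yet below
        -- its target by the strategy.
        rests : ∀ k → Stabilises w k → ¬ ¬ (∃[ i ] k ≤ i × strategy (applyUpTo w i) ≡ nothing)
        rests k st κ = fair (λ j κ′ → κ′ (j + k , m≤m+n j k , λ eq → κ (j + k , m≤n+m k j , eq))) k
          λ (i , k≤i , x , e) → <⇒≱
            (<-≤-trans (strategy-just {applyUpTo w i} (compat i x e)) (entry-bound (goal (applyUpTo w i)) x))
            (subst (λ c → B ≤ level c (inj₁ x)) (sym (st i k≤i))
              (subst (λ σ → B ≤ level (config (applyUpTo w k)) σ) e (stable-saturated st i k≤i)))

    wins⇒winning : Wins {sizeS P} {sizeE P} (gameHeight (sizeE P)) start start → ∃ (Winning φ)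
    wins⇒winning h = _ , ToStrategy.winning (node (gameHeight (sizeE P)) start start h (m≤m+n _ _)) refl

-- Bounding the numbers of processes

-- A witness above `N` can be walked down to `N`, so testing the numbers up to `N` is enough.
dec-cutoff : ∀ {Q : ℕ → Set} → Decidable Q → ∀ N → (∀ n → N ≤ n → Q (suc n) → Q n) → Dec (∃ Q)
dec-cutoff {Q} Q? N down = map′ (λ (n , _ , q) → n , q) (λ (n , q) → small n q) (anyUpTo? Q? (suc N))
  where
  small : ∀ n → Q n → ∃[ k ] k < suc N × Q k
  small zero    q = 0 , s≤s z≤n , q
  small (suc n) q with N ≤? n
  ... | yes l = small n (down n l q)
  ... | no ¬l = suc n , s≤s (≰⇒> ¬l) , q

module Cutoff (A : FiniteSplit) (φ : Sentence A) where
  open Synthesis A φ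
  open Configuration B

  -- Removing System processes

  module SystemCutoff (m : ℕ) where

    -- What a process does during a fixed strategy, for all plays at once.
    Behaviour : ℕ → Set
    Behaviour zero    = Counter B (sizeS A)
    Behaviour (suc r) = Counter B (sizeS A) × Vec (Vec (Behaviour r) m) (sizeE A)

    finite-Behaviour : ∀ r → Finite (Behaviour r)
    finite-Behaviour zero    = finite-Vec (finite-Fin _) _
    finite-Behaviour (suc r) =
      finite-× (finite-Vec (finite-Fin _) _) (finite-Vec (finite-Vec (finite-Behaviour r) m) _)

    behaviour≟ : ∀ r → DecidableEquality (Behaviour r)
    behaviour≟ zero    = _≟C_
    behaviour≟ (suc r) = Product.≡-dec _≟C_ (Vec.≡-dec (Vec.≡-dec (behaviour≟ r)))

    behaviour : ∀ r (s : SystemTeam n) (e : EnvironmentTeam m) → Wins r s e → Fin n → Behaviour r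
    behaviour zero    s e (s′ , _)         p = Vec.lookup s′ p
    behaviour (suc r) s e (s′ , _ , _ , h) p =
      Vec.lookup s′ p , Vec.tabulate λ i → Vec.tabulate λ q → behaviour r s′ (move e (i , q)) (h (i , q)) p

    Similar : ∀ r (s : SystemTeam n) (e : EnvironmentTeam m) → Wins r s e → Fin n → Fin n → Set
    Similar r s e t p q = behaviour r s e t q ≡ behaviour r s e t p

    similar? : ∀ r (s : SystemTeam n) (e : EnvironmentTeam m) t p → Decidable (Similar r s e t p)
    similar? r s e t p q = behaviour≟ r (behaviour r s e t q) (behaviour r s e t p)

    drop-process : SystemTeam (suc n) → Fin (suc n) → SystemTeam n
    drop-process s p = Vec.tabulate λ q → Vec.lookup s (punchIn p q)

    drop-⊑ : ∀ (s s′ : SystemTeam (suc n)) p → s ⊑ s′ → drop-process s p ⊑ drop-process s′ p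
    drop-⊑ s s′ p l (i , q)
      rewrite Vec.lookup∘tabulate (λ q → Vec.lookup s (punchIn p q)) q
            | Vec.lookup∘tabulate (λ q → Vec.lookup s′ (punchIn p q)) q = l (i , punchIn p q)

    drop-accepted : ∀ (s : SystemTeam (suc n)) (e : EnvironmentTeam m) p {Q : Fin n → Set} (Q? : Decidable Q) →
                    B ≤ count Q? → (∀ q → Q q → Vec.lookup s (punchIn p q) ≡ Vec.lookup s p) →
                    Accepted s e → Accepted (drop-process s p) e
    drop-accepted s e p Q? l h = accepted-~ {s = s} {drop-process s p} {e} {e}
      (~-drop s (drop-process s p) p same (≤-trans l
        (count-mono Q? (λ q → Vec.lookup (drop-process s p) q ≟C Vec.lookup s p) λ q x → trans (same q) (h q x))))
      (~-refl e)
      where same = Vec.lookup∘tabulate (λ q → Vec.lookup s (punchIn p q))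

    -- Equal behaviour at the root means equal behaviour in every subtree, so the twins of `p`
    -- remain its twins after each move and stand in for it at every accepted target.
    drop-wins : ∀ r (s : SystemTeam (suc n)) (e : EnvironmentTeam m) (t : Wins r s e) p →
                B ≤ count (similar? r s e t p ∘ punchIn p) → Wins r (drop-process s p) e
    drop-wins zero s e t@(s′ , s⊑s′ , acc , _) p l =
      drop-process s′ p , drop-⊑ s s′ p s⊑s′ ,
      drop-accepted s′ e p (similar? zero s e t p ∘ punchIn p) l (λ q → id) acc , tt
    drop-wins (suc r) s e t@(s′ , s⊑s′ , acc , h) p l =
      drop-process s′ p , drop-⊑ s s′ p s⊑s′ ,
      drop-accepted s′ e p (similar? (suc r) s e t p ∘ punchIn p) l (λ q → cong proj₁) acc ,
      λ (i , j) → drop-wins r s′ (move e (i , j)) (h (i , j)) p (≤-trans l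
        (count-mono (similar? (suc r) s e t p ∘ punchIn p) (similar? r s′ (move e (i , j)) (h (i , j)) p ∘ punchIn p)
          λ q eq → component i j (cong proj₂ eq)))
      where
      component : ∀ {f g : Fin (sizeE A) → Fin m → Behaviour r} i j →
                  Vec.tabulate (λ i → Vec.tabulate (f i)) ≡ Vec.tabulate (λ i → Vec.tabulate (g i)) → f i j ≡ g i j
      component {f} {g} i j eq = trans (sym (at f)) (trans (cong (λ v → Vec.lookup (Vec.lookup v i) j) eq) (at g))
        where
        at : ∀ (f : Fin (sizeE A) → Fin m → Behaviour r) →
             Vec.lookup (Vec.lookup (Vec.tabulate λ i → Vec.tabulate (f i)) i) j ≡ f i j
        at f = trans (cong (λ v → Vec.lookup v j) (Vec.lookup∘tabulate _ i)) (Vec.lookup∘tabulate (f i) j)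

    bound : ℕ → ℕ
    bound r = length (Finite.elements (finite-Behaviour r)) * B

    drop-system : ∀ r (e : EnvironmentTeam m) → bound r ≤ n → Wins {suc n} r start e → Wins {n} r start e
    drop-system {n} r e l t
      -- More than `bound r` processes put more than `B` into one class, that is, some `p` and at
      -- least `B` twins.
      with β , many ← pigeonhole (behaviour≟ r) B (Finite.elements (finite-Behaviour r)) (λ _ → yes tt)
             (behaviour r start e t) (λ p _ → Finite.complete (finite-Behaviour r) _)
             (<-≤-trans (s≤s l) (count-all {suc n} (λ _ → yes tt) λ _ → tt))
      = let Q? = λ p → yes tt ×-dec behaviour≟ r (behaviour r start e t p) β
            p , _ , eq = count-∃ Q? (≤-<-trans z≤n many)
        -- No equality between the shortened `start` and `start` is needed: the base is only a lower
        -- bound in `Wins`.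
        in wins-antitone r {start} {drop-process start p} (start-⊑ (drop-process start p)) (drop-wins r start e t p
             (≤-trans (s≤s⁻¹ (≤-trans many (count-punchIn Q? p)))
               (count-mono (Q? ∘ punchIn p) (similar? r start e t p ∘ punchIn p) λ q (_ , eq′) → trans eq′ (sym eq))))

  -- Removing Environment processes

  module EnvironmentCutoff where

    EnvironmentCounter : Set
    EnvironmentCounter = Counter B (sizeE A)

    finite-Counter : Finite EnvironmentCounter
    finite-Counter = finite-Vec (finite-Fin _) _

    top : ℕ
    top = sizeE A * B

    Reach : EnvironmentCounter → EnvironmentCounter → Set
    Reach g v = ∃[ ks ] foldl (flip increment) g ks ≡ v

    reach-trans : ∀ {g v w} → Reach g v → Reach v w → Reach g w
    reach-trans {g} (ks , refl) (js , refl) = ks ++ js , List.foldl-++ (flip increment) g ks js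

    reach-grows : ∀ {g v} → Reach g v → v ≡ g ⊎ height g < height v
    reach-grows ([] , refl) = inj₁ refl
    reach-grows {g} {v} (i ∷ ks , eq) with increment-grows i g | reach-grows {increment i g} {v} (ks , eq)
    ... | inj₁ e | inj₁ e′ = inj₁ (trans e′ e)
    ... | inj₁ e | inj₂ l  = inj₂ (subst (λ g → height g < height v) e l)
    ... | inj₂ l | inj₁ e′ = inj₂ (subst (λ v → height g < height v) (sym e′) l)
    ... | inj₂ l | inj₂ l′ = inj₂ (<-trans l l′)

    reach-moves : ∀ (e : EnvironmentTeam m) xs p → Reach (Vec.lookup e p) (Vec.lookup (foldl move e xs) p)
    reach-moves e []             p = [] , refl
    reach-moves e ((i , q) ∷ xs) p = reach-trans one (reach-moves (move e (i , q)) xs p)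
      where
      one : Reach (Vec.lookup e p) (Vec.lookup (move e (i , q)) p)
      one with p Fin.≟ q
      ... | yes refl = i ∷ [] , sym (Vec.lookup∘updateAt p {increment i} e)
      ... | no ne    = [] , sym (Vec.lookup∘updateAt′ p q {increment i} ne e)

    -- `k` bounds how many more times the ghost can rise. Each rise keeps only the members at one of
    -- the finitely many counters, whence the factor; the summand `B` makes any crowd large enough
    -- to hide the ghost.
    crowdSize : ℕ → ℕ
    crowdSize zero    = B
    crowdSize (suc k) = B + length (Finite.elements finite-Counter) * crowdSize k

    B≤crowdSize : ∀ k → B ≤ crowdSize k
    B≤crowdSize zero    = ≤-refl
    B≤crowdSize (suc k) = m≤m+n B _

    -- The members of the crowd were all at g when the ghost arrived there.
    record Crowd (g : EnvironmentCounter) (e : EnvironmentTeam m) : Set₁ where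
      field
        {level} : ℕ
        {Member} : Fin m → Set
        member? : Decidable Member
        size    : crowdSize level < count member?
        high    : top ≤ level + height g
        reach   : ∀ p → Member p → Reach g (Vec.lookup e p)

    crowd-moves : ∀ {g} {e : EnvironmentTeam m} xs → Crowd g e → Crowd g (foldl move e xs)
    crowd-moves {e = e} xs c = record { Crowd c
      ; reach = λ p t → reach-trans (Crowd.reach c p t) (reach-moves e xs p) }

    Hidden : EnvironmentCounter → EnvironmentTeam m → Set
    Hidden g e = B ≤ count λ p → Vec.lookup e p ≟C g

    -- At level zero `g` has the greatest possible height, so nobody has left it. Otherwise a
    -- popular counter `v` is chosen: if it is `g`, the ghost stays and keeps its whole crowd; if
    -- not, `v` is strictly higher, which pays for the lower level of the crowd now at `v`.
    hide : ∀ {g} {e : EnvironmentTeam m} → Crowd g e → ∃[ g′ ] Reach g g′ × Crowd g′ e × Hidden g′ e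
    hide {g = g} {e} c@record { level = zero ; member? = T? ; size = size ; high = high ; reach = reach } =
      g , ([] , refl) , c , ≤-trans (<⇒≤ size) (count-mono T? (λ p → Vec.lookup e p ≟C g) at-top)
      where
      at-top : ∀ p → Crowd.Member c p → Vec.lookup e p ≡ g
      at-top p t with reach-grows (reach p t)
      ... | inj₁ eq = eq
      ... | inj₂ l  = ⊥-elim (<⇒≱ l (≤-trans (height-bound (Vec.lookup e p)) high))
    hide {g = g} {e} c@record { level = suc k ; member? = T? ; size = size ; high = high ; reach = reach }
      with v , many ← pigeonhole _≟C_ (crowdSize k) (Finite.elements finite-Counter) T? (Vec.lookup e)
             (λ p _ → Finite.complete finite-Counter _) (≤-<-trans (m≤n+m _ B) size)
      with p , t , refl ← count-∃ (λ p → T? p ×-dec (Vec.lookup e p ≟C v)) (≤-<-trans z≤n many)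
      with reach-grows (reach p t)
    ... | inj₁ eq = g , ([] , refl) , c , ≤-trans (B≤crowdSize k) (≤-trans (<⇒≤ many)
            (count-mono _ (λ q → Vec.lookup e q ≟C g) λ q (_ , eq′) → trans eq′ eq))
    ... | inj₂ l  = Vec.lookup e p , reach p t ,
      record { member? = λ q → T? q ×-dec (Vec.lookup e q ≟C Vec.lookup e p) ; size = many
             ; high = ≤-trans high (≤-trans (≤-reflexive (sym (+-suc k _))) (+-monoʳ-≤ k l))
             ; reach = λ q (_ , eq) → [] , sym eq } ,
      ≤-trans (B≤crowdSize k) (≤-trans (<⇒≤ many) (count-mono _ (λ q → Vec.lookup e q ≟C Vec.lookup e p) λ q → proj₂))

    moves-suc : ∀ g (e : EnvironmentTeam m) xs →
                foldl move (g ∷ e) (List.map (λ (i , p) → i , suc p) xs) ≡ g ∷ foldl move e xs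
    moves-suc g e []       = refl
    moves-suc g e (x ∷ xs) = moves-suc g (move e x) xs

    moves-zero : ∀ g (e : EnvironmentTeam m) ks →
                 foldl move (g ∷ e) (List.map (λ i → i , zero) ks) ≡ foldl (flip increment) g ks ∷ e
    moves-zero g e []       = refl
    moves-zero g e (i ∷ ks) = moves-zero (increment i g) e ks

    -- The ghost is process `zero` of `g ∷ e`. It has to be hidden only when acceptance is tested,
    -- so its own path joins the same burst as the real moves, and the number of rounds stays the
    -- same.
    drop-ghost : ∀ r {s : SystemTeam n} {g} {e : EnvironmentTeam m} → Crowd g e → Hidden g e →
                 WinsC r s (g ∷ e) → WinsC r s e
    after-drop : ∀ r {s : SystemTeam n} {g} {e : EnvironmentTeam m} → Crowd g e →
                 AfterC r s (g ∷ e) → AfterC r s e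
    drop-ghost r {g = g} {e} c hidden h κ = h λ (s′ , s⊑s′ , acc , next) →
      κ (s′ , s⊑s′ ,
         accepted-~ {s = s′} {s′} {g ∷ e} {e} (~-refl s′) (~-drop (g ∷ e) e zero (λ _ → refl) hidden) acc ,
         after-drop r {s′} c next)
    after-drop zero    c h    = tt
    after-drop (suc r) {s} {g} {e} c h xs
      with g′ , (ks , refl) , c′ , hidden ← hide (crowd-moves xs c)
      = drop-ghost r {s} c′ hidden (subst (WinsC r s) moves
          -- The real moves come first, because the hiding place depends on where they lead; the
          -- path of the ghost follows.
          (h (List.map (λ (i , p) → i , suc p) xs ++ List.map (λ i → i , zero) ks)))
      where
      open ≡-Reasoning
      moves : foldl move (g ∷ e) (List.map (λ (i , p) → i , suc p) xs ++ List.map (λ i → i , zero) ks) ≡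
              foldl (flip increment) g ks ∷ foldl move e xs
      moves = begin
        foldl move (g ∷ e) (List.map (λ (i , p) → i , suc p) xs ++ List.map (λ i → i , zero) ks)
          ≡⟨ List.foldl-++ move (g ∷ e) (List.map (λ (i , p) → i , suc p) xs) _ ⟩
        foldl move (foldl move (g ∷ e) (List.map (λ (i , p) → i , suc p) xs)) (List.map (λ i → i , zero) ks)
          ≡⟨ cong (λ e → foldl move e (List.map (λ i → i , zero) ks)) (moves-suc g e xs) ⟩
        foldl move (g ∷ foldl move e xs) (List.map (λ i → i , zero) ks)
          ≡⟨ moves-zero g (foldl move e xs) ks ⟩
        foldl (flip increment) g ks ∷ foldl move e xs ∎

    -- The ghost can rise at most `top` times from the start; the successor is there because a crowd
    -- is strictly larger than its `crowdSize`.
    bound : ℕ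
    bound = suc (crowdSize top)

    drop-environment : ∀ r {s : SystemTeam n} → bound ≤ m → WinsC r s (start {n = suc m}) → WinsC r s (start {n = m})
    drop-environment {m = m} r {s} l = drop-ghost r {s}
      (record { member? = λ _ → yes tt ; size = <-≤-trans l (count-all (λ _ → yes tt) λ _ → tt)
              ; high = m≤m+n top _ ; reach = λ p _ → [] , sym (Vec.lookup-replicate p _) })
      (≤-trans (B≤crowdSize top) (≤-trans (≤-trans (n≤1+n _) l)
        (count-all (λ p → Vec.lookup (start {n = m}) p ≟C _) λ p → Vec.lookup-replicate p _)))

  -- The decision procedure

  Winnable : ℕ → ℕ → Set
  Winnable m n = ∃ (Game.Winning A (split n m) φ)

  winnable⇒winsC : Winnable m n → ∀ r → WinsC {n} {m} r start start
  winnable⇒winsC {m} {n} (_ , w) = Play.winning⇒winsC (split n m) w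

  wins⇒winnable : Wins {n} {m} (gameHeight m) start start → Winnable m n
  wins⇒winnable {n} {m} = Play.wins⇒winning (split n m)

  winnable⇒wins : Winnable m n → ∀ r → Wins {n} {m} r start start
  winnable⇒wins {m} {n} w r = winsC⇒wins r {start} {start} (winnable⇒winsC {m} {n} w r)

  winnable? : ∀ m → Decidable (Winnable m)
  winnable? m n = map′ wins⇒winnable (λ w → winnable⇒wins {m} w (gameHeight m)) (wins? (gameHeight m) start start)

  system-cutoff : ∀ m → Dec (∃ (Winnable m))
  system-cutoff m = dec-cutoff (winnable? m) (bound (gameHeight m)) λ n l w →
    wins⇒winnable {n} {m} (drop-system (gameHeight m) start l (winnable⇒wins {m} w (gameHeight m)))
    where open SystemCutoff m

  environment-cutoff : Dec (∃[ m ] ∃ (Winnable m))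
  environment-cutoff = dec-cutoff system-cutoff bound λ m l (n , w) →
    n , wins⇒winnable {n} {m} (winsC⇒wins (gameHeight m) {start} {start}
      -- A winning strategy yields games of every length, so the length suited to `m` processes can
      -- be asked of `suc m` of them.
      (drop-environment (gameHeight m) {start} l (winnable⇒winsC {suc m} w (gameHeight m))))
    where open EnvironmentCutoff

theorem2 : (A : FiniteSplit) → Decidable (PartSynth A)
theorem2 A φ = map′ (λ (m , n , w) → split n m , w) (λ (split n m , w) → m , n , w) environment-cutoff
  where open Cutoff A φ
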